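{- Fix a positive integer $k$ and a real $\epsilon>0$. Given the data $(A,b,d)$ of a $k$-dimensional (packing) knapsack instance, there is a polynomial-sized extended LP relaxation $L$ of the feasible region $\{x\in\mathbb{Z}^n \mid 0\le x\le d, Ax\le b\}$, whose constraints do not depend on the value vector $c$, such that for the integer program $P=\{\max cx \mid x\in\mathbb{Z}^n, 0\le x\le d, Ax\le b\}$ one has $\mathrm{OPT}(P)\ge(1-\epsilon)\,\mathrm{OPT}(L)$, where $L$ is given the objective $\max cx$.
   Context: A $k$-dimensional knapsack instance is given by a nonnegative integral $k\times n$ matrix $A$, a nonnegative integral vector $b\in\mathbb{Z}^k$, a vector $d$ of length $n$ whose entries are nonnegative integers or $+\infty$, and a nonnegative vector $c\in\mathbb{R}^n$ of item values; the problem is $P=\{\max cx \mid x\in\mathbb{Z}^n, 0\le x\le d, Ax\le b\}$. An extended LP relaxation $L$ of $P$ is a linear program whose variables are the $n$ variables $x$ of $P$ together with additional variables, such that the projection of the feasible region of $L$ onto the $x$-variables contains exactly the same integral points as the feasible region of $P$, and whose objective function is $cx$ (ignoring the additional variables). "Polynomial-sized" means the number of variables and constraints of $L$ is bounded by a polynomial in the input size (for fixed $k$ and $\epsilon$).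
   Formalization: The real number ε, the item values c and the points (variables) of the linear program L are taken to be rational instead of real. -}

module Defs where

open import Data.Nat as ℕ using (ℕ; zero; suc)
open import Data.Nat.Logarithm using (⌊log₂_⌋)
open import Data.Integer as ℤ using (ℤ; +_)
open import Data.Rational as ℚ using (ℚ; 0ℚ; 1ℚ)
open import Data.Fin using (Fin; zero; suc)
open import Data.Maybe using (Maybe; just; nothing)
open import Data.Product using (Σ; ∃; _×_)
open import Function.Bundles using (_⇔_)
open import Data.Unit using (⊤)

Σℕ : ∀ {n} → (Fin n → ℕ) → ℕ
Σℕ {zero}  f = 0
Σℕ {suc n} f = f zero ℕ.+ Σℕ (λ i → f (suc i))

Σℤ : ∀ {n} → (Fin n → ℤ) → ℤ
Σℤ {zero}  f = + 0
Σℤ {suc n} f = f zero ℤ.+ Σℤ (λ i → f (suc i))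

Σℚ : ∀ {n} → (Fin n → ℚ) → ℚ
Σℚ {zero}  f = 0ℚ
Σℚ {suc n} f = f zero ℚ.+ Σℚ (λ i → f (suc i))

toℚ : ℤ → ℚ
toℚ z = z ℚ./ 1

-- k-dimensional knapsack instance data (A, b, d) with n items.
-- d i = nothing encodes d_i = +∞.

record KnapsackData (k : ℕ) : Set where
  field
    n : ℕ
    A : Fin k → Fin n → ℕ
    b : Fin k → ℕ
    d : Fin n → Maybe ℕ

BelowBound : ℤ → Maybe ℕ → Set
BelowBound x nothing  = ⊤
BelowBound x (just u) = x ℤ.≤ + u

KnapsackFeasible : ∀ {k} (I : KnapsackData k) → (Fin (KnapsackData.n I) → ℤ) → Set
KnapsackFeasible {k} I x =
  ((i : Fin n) → (+ 0 ℤ.≤ x i) × BelowBound (x i) (d i)) ×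
  ((j : Fin k) → Σℤ (λ i → + (A j i) ℤ.* x i) ℤ.≤ + (b j))
  where open KnapsackData I

bitLength : ℕ → ℕ
bitLength m = suc ⌊log₂ m ⌋

bitLength∞ : Maybe ℕ → ℕ
bitLength∞ nothing  = 1
bitLength∞ (just u) = bitLength u

inputSize : ∀ {k} → KnapsackData k → ℕ
inputSize {k} I =
  k ℕ.+ n ℕ.+ Σℕ (λ j → Σℕ (λ i → bitLength (A j i)))
      ℕ.+ Σℕ (λ j → bitLength (b j)) ℕ.+ Σℕ (λ i → bitLength∞ (d i))
  where open KnapsackData I

-- A linear program in variables (x, y), x ∈ ℚⁿ the original variables,
-- y ∈ ℚᵐ additional variables, with r constraints  Gx·x + Gy·y ≤ h.
-- (Equations are expressed as pairs of inequalities.)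

record ExtLP (n : ℕ) : Set where
  field
    extraVars   : ℕ
    constraints : ℕ
    Gx : Fin constraints → Fin n → ℚ
    Gy : Fin constraints → Fin extraVars → ℚ
    h  : Fin constraints → ℚ

lpSize : ∀ {n} → ExtLP n → ℕ
lpSize {n} L = n ℕ.+ ExtLP.extraVars L ℕ.+ ExtLP.constraints L

LPFeasible : ∀ {n} (L : ExtLP n) → (Fin n → ℚ) → (Fin (ExtLP.extraVars L) → ℚ) → Set
LPFeasible L x y =
  (j : Fin constraints) →
    Σℚ (λ i → Gx j i ℚ.* x i) ℚ.+ Σℚ (λ i → Gy j i ℚ.* y i) ℚ.≤ h j
  where open ExtLP L

IsExtendedRelaxation : ∀ {k} (I : KnapsackData k) → ExtLP (KnapsackData.n I) → Set
IsExtendedRelaxation I L =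
  (z : Fin (KnapsackData.n I) → ℤ) →
    (∃ λ y → LPFeasible L (λ i → toℚ (z i)) y) ⇔ KnapsackFeasible I z

value : ∀ {n} → (Fin n → ℚ) → (Fin n → ℚ) → ℚ
value c x = Σℚ (λ i → c i ℚ.* x i)

-- OPT(P) ≥ (1 - ε) OPT(L) for the objective max cx:
-- every feasible point (x, y) of L is matched by an integral feasible
-- point z of P with c·z ≥ (1 - ε) c·x.
ApproxGuarantee : ∀ {k} (I : KnapsackData k) → ExtLP (KnapsackData.n I) →
                  ℚ → (Fin (KnapsackData.n I) → ℚ) → Set
ApproxGuarantee I L ε c =
  ∀ x y → LPFeasible L x y →
    ∃ λ z → KnapsackFeasible I z ×
      ((1ℚ ℚ.- ε) ℚ.* value c x ℚ.≤ value c (λ i → toℚ (z i)))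

{-# OPTIONS --safe #-}

-- For each row j guess a multiset S_j of γ = g k units of a solution that are heaviest with respect to A_j, where
-- k ≤ g ε (short solutions are padded by weightless dummies).  The guess bounds x by a box: x contains every S_j, and
-- an item heavier in row j than some unit of S_j occurs exactly as often as in S_j.  Every feasible integral point
-- lies in the box of some guess, and the relaxation is the disjunctive (Balas) formulation of the union of the
-- polynomially many polytopes { box, A x ≤ b }; nothing depends on c.  A point of one such polytope can be moved,
-- without loss of profit, to one with at most k coordinates strictly inside the box.  Rounding these up overloads
-- row j by at most k units, each no heavier than any unit of S_j.  So removing, for every j, the cheapest of g
-- blocks of k units of S_j restores feasibility, and loses at most a fraction k / g ≤ ε of the profit.

module Submission where

open import Defs
open import Algebra.Structures using (IsCommutativeSemiring; IsCommutativeRing)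
open import Data.Bool using (Bool; true; false; if_then_else_; _∧_; not)
import Data.Bool.Properties as Boolₚ
open import Data.Fin using (Fin; zero; suc; _↑ˡ_; _↑ʳ_; combine; remQuot; finToFun; funToFin)
import Data.Fin as Fin
import Data.Fin.Properties as Finₚ
open import Data.Integer as ℤ using (ℤ; +_; -[1+_])
import Data.Integer.Properties as ℤₚ
open import Data.List as List using (List; []; _∷_; _++_)
import Data.List.Properties as Listₚ
open import Data.List.Relation.Unary.All as All using (All; []; _∷_)
import Data.List.Relation.Unary.All.Properties as Allₚ
open import Data.Maybe using (just; nothing)
open import Data.Nat as ℕ using (ℕ; zero; suc; _^_; z≤n; s≤s)
open import Data.Nat.Coprimality using (1-coprimeTo; sym)
import Data.Nat.Properties as ℕₚ
import Data.Nat.Solver as ℕ-Solver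
open import Data.Product using (Σ; ∃; _×_; _,_; proj₁; proj₂)
open import Data.Rational as ℚ using (ℚ; 0ℚ; 1ℚ; mkℚ; *≤*; 1/_)
import Data.Rational.Properties as ℚₚ
open import Data.Rational.Solver using (module +-*-Solver)
open import Data.Sum using (_⊎_; inj₁; inj₂)
open import Data.Unit using (⊤; tt)
open import Function.Base using (_∘_; case_of_)
open import Function.Bundles using (mk⇔)
open import Level using (0ℓ)
open import Relation.Binary.Definitions using (Total; Transitive; Reflexive; tri<; tri≈; tri>)
open import Relation.Binary.PropositionalEquality as ≡
  using (_≡_; _≢_; refl; cong; cong₂; subst; subst₂; trans; module ≡-Reasoning)
open import Relation.Nullary using (¬_; Dec; yes; no; does; contradiction)
open import Relation.Nullary.Decidable using (¬?; _×-dec_; dec-true; dec-false; decidable-stable)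
open import Relation.Unary using (Pred; Decidable)

-- The guarantee is pointwise: every feasible point of `L` is rounded, so neither LP duality nor
-- attainment of OPT(L) enters, and vertices are replaced by repeated moves along kernel directions.
-- Units are guessed by weight but dropped by profit. Any k units of S_j make enough room in row j,
-- so the choice among them is free to follow `c`; γ = g k provides g disjoint choices, and the
-- cheapest of them holds at most 1/g of the profit of S_j. The obstacle to the disjunctive
-- formulation is unboundedness: an item with `d i = nothing` and a zero column may grow without
-- limit. Such items stay outside the disjunction, constrained by nonnegativity alone, and are
-- rounded up at the end without using any capacity. All others have a finite bound, so a disjunct
-- of weight 0 collapses to the origin. Inconsistent guesses may remain in `L`, since an empty
-- disjunct forces its weight to be 0.

-- Finite sums over commutative semirings.

module BigSum
  {A : Set} {_+_ _*_ : A → A → A} {0# 1# : A} {_≤_ : A → A → Set}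
  (isCommutativeSemiring : IsCommutativeSemiring _≡_ _+_ _*_ 0# 1#)
  (≤-refl : ∀ {x} → x ≤ x)
  (+-mono-≤ : ∀ {x y u v} → x ≤ y → u ≤ v → (x + u) ≤ (y + v))
  (Sum : ∀ {n} → (Fin n → A) → A)
  (Sum-zero : ∀ f → Sum {0} f ≡ 0#)
  (Sum-suc : ∀ {n} f → Sum {suc n} f ≡ f zero + Sum (f ∘ suc))
  where

  open IsCommutativeSemiring isCommutativeSemiring
    using (+-assoc; +-comm; +-identityˡ; +-identityʳ; *-comm; *-identityˡ; *-identityʳ;
           distribˡ; zeroˡ; zeroʳ)
  open ≡-Reasoning

  Σ-cong : ∀ {n} {f g : Fin n → A} → (∀ i → f i ≡ g i) → Sum f ≡ Sum g
  Σ-cong {zero} {f} {g} eq = begin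
    Sum f ≡⟨ Sum-zero f ⟩
    0#    ≡⟨ Sum-zero g ⟨
    Sum g ∎
  Σ-cong {suc n} {f} {g} eq = begin
    Sum f                   ≡⟨ Sum-suc f ⟩
    f zero + Sum (f ∘ suc)  ≡⟨ cong₂ _+_ (eq zero) (Σ-cong (eq ∘ suc)) ⟩
    g zero + Sum (g ∘ suc)  ≡⟨ Sum-suc g ⟨
    Sum g                   ∎

  Σ-zero : ∀ {n} → Sum {n} (λ _ → 0#) ≡ 0#
  Σ-zero {zero} = Sum-zero _
  Σ-zero {suc n} = begin
    Sum {suc n} (λ _ → 0#)   ≡⟨ Sum-suc _ ⟩
    0# + Sum {n} (λ _ → 0#)  ≡⟨ +-identityˡ _ ⟩
    Sum {n} (λ _ → 0#)       ≡⟨ Σ-zero {n} ⟩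
    0#                       ∎

  Σ-distrib-+ : ∀ {n} (f g : Fin n → A) → Sum (λ i → f i + g i) ≡ Sum f + Sum g
  Σ-distrib-+ {zero} f g = begin
    Sum (λ i → f i + g i)  ≡⟨ Sum-zero _ ⟩
    0#                     ≡⟨ +-identityˡ 0# ⟨
    0# + 0#                ≡⟨ cong₂ _+_ (Sum-zero f) (Sum-zero g) ⟨
    Sum f + Sum g          ∎
  Σ-distrib-+ {suc n} f g = begin
    Sum (λ i → f i + g i)                                ≡⟨ Sum-suc _ ⟩
    (f zero + g zero) + Sum (λ i → f (suc i) + g (suc i))
      ≡⟨ cong₂ _+_ refl (Σ-distrib-+ (f ∘ suc) (g ∘ suc)) ⟩
    (f zero + g zero) + (F + G)                          ≡⟨ +-assoc _ _ _ ⟩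
    f zero + (g zero + (F + G))                          ≡⟨ cong₂ _+_ refl (+-assoc _ _ _) ⟨
    f zero + ((g zero + F) + G)
      ≡⟨ cong (λ a → f zero + (a + G)) (+-comm (g zero) F) ⟩
    f zero + ((F + g zero) + G)                          ≡⟨ cong₂ _+_ refl (+-assoc _ _ _) ⟩
    f zero + (F + (g zero + G))                          ≡⟨ +-assoc _ _ _ ⟨
    (f zero + F) + (g zero + G)                          ≡⟨ cong₂ _+_ (Sum-suc f) (Sum-suc g) ⟨
    Sum f + Sum g                                        ∎
    where
    F G : A
    F = Sum (f ∘ suc)
    G = Sum (g ∘ suc)

  Σ-distribˡ-* : ∀ {n} c (f : Fin n → A) → Sum (λ i → c * f i) ≡ c * Sum f
  Σ-distribˡ-* {zero} c f = begin
    Sum (λ i → c * f i)  ≡⟨ Sum-zero _ ⟩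
    0#                   ≡⟨ zeroʳ c ⟨
    c * 0#               ≡⟨ cong (c *_) (Sum-zero f) ⟨
    c * Sum f            ∎
  Σ-distribˡ-* {suc n} c f = begin
    Sum (λ i → c * f i)                          ≡⟨ Sum-suc _ ⟩
    (c * f zero) + Sum (λ i → c * f (suc i))     ≡⟨ cong₂ _+_ refl (Σ-distribˡ-* c (f ∘ suc)) ⟩
    (c * f zero) + (c * Sum (f ∘ suc))           ≡⟨ distribˡ c _ _ ⟨
    c * (f zero + Sum (f ∘ suc))                 ≡⟨ cong (c *_) (Sum-suc f) ⟨
    c * Sum f                                    ∎

  Σ-distribʳ-* : ∀ {n} c (f : Fin n → A) → Sum (λ i → f i * c) ≡ Sum f * c
  Σ-distribʳ-* c f = begin
    Sum (λ i → f i * c)  ≡⟨ Σ-cong (λ i → *-comm (f i) c) ⟩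
    Sum (λ i → c * f i)  ≡⟨ Σ-distribˡ-* c f ⟩
    c * Sum f            ≡⟨ *-comm c _ ⟩
    Sum f * c            ∎

  Σ-const : ∀ {n} c → Sum {n} (λ _ → c) ≡ Sum {n} (λ _ → 1#) * c
  Σ-const c = ≡.trans (Σ-cong (λ _ → ≡.sym (*-identityˡ c))) (Σ-distribʳ-* c (λ _ → 1#))

  Σ-swap : ∀ {m n} (f : Fin m → Fin n → A) →
           Sum (λ i → Sum (λ j → f i j)) ≡ Sum (λ j → Sum (λ i → f i j))
  Σ-swap {zero} {n} f = begin
    Sum (λ i → Sum (f i))              ≡⟨ Sum-zero _ ⟩
    0#                                 ≡⟨ Σ-zero {n} ⟨
    Sum {n} (λ _ → 0#)                 ≡⟨ Σ-cong (λ j → Sum-zero (λ i → f i j)) ⟨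
    Sum (λ j → Sum (λ i → f i j))      ∎
  Σ-swap {suc m} f = begin
    Sum (λ i → Sum (f i))                                      ≡⟨ Sum-suc _ ⟩
    Sum (f zero) + Sum (λ i → Sum (f (suc i)))                 ≡⟨ cong₂ _+_ refl (Σ-swap (f ∘ suc)) ⟩
    Sum (f zero) + Sum (λ j → Sum (λ i → f (suc i) j))         ≡⟨ Σ-distrib-+ (f zero) _ ⟨
    Sum (λ j → f zero j + Sum (λ i → f (suc i) j))             ≡⟨ Σ-cong (λ j → Sum-suc (λ i → f i j)) ⟨
    Sum (λ j → Sum (λ i → f i j))                              ∎

  Σ-mono : ∀ {n} {f g : Fin n → A} → (∀ i → f i ≤ g i) → Sum f ≤ Sum g
  Σ-mono {zero} {f} {g} le = subst₂ _≤_ (≡.sym (Sum-zero f)) (≡.sym (Sum-zero g)) ≤-refl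
  Σ-mono {suc n} {f} {g} le =
    subst₂ _≤_ (≡.sym (Sum-suc f)) (≡.sym (Sum-suc g)) (+-mono-≤ (le zero) (Σ-mono (le ∘ suc)))

  Σ-nonneg : ∀ {n} {f : Fin n → A} → (∀ i → 0# ≤ f i) → 0# ≤ Sum f
  Σ-nonneg {n} {f} le = subst (_≤ Sum f) (Σ-zero {n}) (Σ-mono le)

  Σ-term-≤ : ∀ {n} {f : Fin n → A} → (∀ i → 0# ≤ f i) → ∀ p → f p ≤ Sum f
  Σ-term-≤ {suc n} {f} le zero =
    subst₂ _≤_ (+-identityʳ _) (≡.sym (Sum-suc f)) (+-mono-≤ ≤-refl (Σ-nonneg (le ∘ suc)))
  Σ-term-≤ {suc n} {f} le (suc p) =
    subst₂ _≤_ (+-identityˡ _) (≡.sym (Sum-suc f)) (+-mono-≤ (le zero) (Σ-term-≤ (le ∘ suc) p))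

  δ : ∀ {n} → Fin n → Fin n → A
  δ p i = if does (p Fin.≟ i) then 1# else 0#

  δ-refl : ∀ {n} (p : Fin n) → δ p p ≡ 1#
  δ-refl p rewrite dec-true (p Fin.≟ p) refl = refl

  δ-≢ : ∀ {n} {p i : Fin n} → p ≢ i → δ p i ≡ 0#
  δ-≢ {p = p} {i} p≢i rewrite dec-false (p Fin.≟ i) p≢i = refl

  Σ-δ : ∀ {n} p (f : Fin n → A) → Sum (λ i → δ p i * f i) ≡ f p
  Σ-δ {suc n} zero f = begin
    Sum (λ i → δ zero i * f i)                      ≡⟨ Sum-suc _ ⟩
    (1# * f zero) + Sum (λ i → 0# * f (suc i))
      ≡⟨ cong₂ _+_ (*-identityˡ _) (≡.trans (Σ-cong (λ i → zeroˡ _)) (Σ-zero {n})) ⟩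
    f zero + 0#                                     ≡⟨ +-identityʳ _ ⟩
    f zero                                          ∎
  Σ-δ {suc n} (suc p) f = begin
    Sum (λ i → δ (suc p) i * f i)                   ≡⟨ Sum-suc _ ⟩
    (0# * f zero) + Sum (λ i → δ p i * f (suc i))   ≡⟨ cong₂ _+_ (zeroˡ _) (Σ-δ p (f ∘ suc)) ⟩
    0# + f (suc p)                                  ≡⟨ +-identityˡ _ ⟩
    f (suc p)                                       ∎

  Σ-δ-1 : ∀ {n} (p : Fin n) → Sum (δ p) ≡ 1#
  Σ-δ-1 p = ≡.trans (Σ-cong (λ i → ≡.sym (*-identityʳ (δ p i)))) (Σ-δ p (λ _ → 1#))

  Σ-split : ∀ m {n} (f : Fin (m ℕ.+ n) → A) →
            Sum f ≡ Sum (λ i → f (i ↑ˡ n)) + Sum (λ i → f (m ↑ʳ i))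
  Σ-split zero f = ≡.sym (≡.trans (cong₂ _+_ (Sum-zero _) refl) (+-identityˡ _))
  Σ-split (suc m) f = begin
    Sum f                                          ≡⟨ Sum-suc f ⟩
    f zero + Sum (f ∘ suc)                         ≡⟨ cong₂ _+_ refl (Σ-split m (f ∘ suc)) ⟩
    f zero + (_ + _)                               ≡⟨ +-assoc _ _ _ ⟨
    (f zero + _) + _                               ≡⟨ cong₂ _+_ (Sum-suc _) refl ⟨
    _                                              ∎

  Σ-combine : ∀ m {n} (f : Fin (m ℕ.* n) → A) →
              Sum f ≡ Sum (λ i → Sum (λ j → f (combine {m} {n} i j)))
  Σ-combine zero f = ≡.trans (Sum-zero f) (≡.sym (Sum-zero _))
  Σ-combine (suc m) {n} f = begin
    Sum f                                                        ≡⟨ Σ-split n f ⟩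
    _ + Sum (λ i → f (n ↑ʳ i))                                   ≡⟨ cong₂ _+_ refl (Σ-combine m _) ⟩
    _ + _                                                        ≡⟨ Sum-suc _ ⟨
    _                                                            ∎

-- Both instances interpret `Sum` by the sums of the problem statement, whose recursion equations
-- hold by definition, so one set of lemmas serves natural and rational numbers.
module ℕΣ = BigSum {_≤_ = ℕ._≤_} ℕₚ.+-*-isCommutativeSemiring ℕₚ.≤-refl ℕₚ.+-mono-≤ Σℕ (λ _ → refl) (λ _ → refl)
module ℚΣ = BigSum {_≤_ = ℚ._≤_} (IsCommutativeRing.isCommutativeSemiring ℚₚ.+-*-isCommutativeRing)
                   ℚₚ.≤-refl ℚₚ.+-mono-≤ Σℚ (λ _ → refl) (λ _ → refl)

-- Integers and natural numbers inside the rationals.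

-- Division by 1 passes through gcd normalisation, which is stuck on a variable; the normal form
-- exposes numerator and denominator to the arithmetic of `ℚ`.
toℚ≡mkℚ : ∀ z → toℚ z ≡ mkℚ z 0 (sym (1-coprimeTo ℤ.∣ z ∣))
toℚ≡mkℚ z = ℚₚ.↥p/↧p≡p (mkℚ z 0 (sym (1-coprimeTo ℤ.∣ z ∣)))

toℚ-homo-+ : ∀ a b → toℚ (a ℤ.+ b) ≡ toℚ a ℚ.+ toℚ b
toℚ-homo-+ a b = ≡.sym (begin
  toℚ a ℚ.+ toℚ b                                ≡⟨ cong₂ ℚ._+_ (toℚ≡mkℚ a) (toℚ≡mkℚ b) ⟩
  toℚ (a ℤ.* ℤ.1ℤ ℤ.+ b ℤ.* ℤ.1ℤ)                ≡⟨ cong toℚ (cong₂ ℤ._+_ (ℤₚ.*-identityʳ a) (ℤₚ.*-identityʳ b)) ⟩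
  toℚ (a ℤ.+ b)                                  ∎)
  where open ≡-Reasoning

toℚ-homo-* : ∀ a b → toℚ (a ℤ.* b) ≡ toℚ a ℚ.* toℚ b
toℚ-homo-* a b = ≡.sym (cong₂ ℚ._*_ (toℚ≡mkℚ a) (toℚ≡mkℚ b))

toℚ-mono-≤ : ∀ {a b} → a ℤ.≤ b → toℚ a ℚ.≤ toℚ b
toℚ-mono-≤ {a} {b} a≤b rewrite toℚ≡mkℚ a | toℚ≡mkℚ b = *≤* (ℤₚ.*-monoʳ-≤-nonNeg ℤ.1ℤ a≤b)

toℚ-cancel-≤ : ∀ {a b} → toℚ a ℚ.≤ toℚ b → a ℤ.≤ b
toℚ-cancel-≤ {a} {b} a≤b rewrite toℚ≡mkℚ a | toℚ≡mkℚ b with *≤* le ← a≤b =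
  ℤₚ.*-cancelʳ-≤-pos a b ℤ.1ℤ le

toℚ-Σ : ∀ {n} (f : Fin n → ℤ) → toℚ (Σℤ f) ≡ Σℚ (λ i → toℚ (f i))
toℚ-Σ {zero} f = refl
toℚ-Σ {suc n} f = trans (toℚ-homo-+ (f zero) _) (cong (toℚ (f zero) ℚ.+_) (toℚ-Σ (f ∘ suc)))

opaque

  -- Opaque, to keep the normalisation inside `toℚ` from unfolding in later goals, which rely on the
  -- laws of this block only.
  ι : ℕ → ℚ
  ι m = toℚ (+ m)

  toℚ≡ι : ∀ m → toℚ (+ m) ≡ ι m
  toℚ≡ι m = refl

  ι-0 : ι 0 ≡ 0ℚ
  ι-0 = refl

  ι-1 : ι 1 ≡ 1ℚ
  ι-1 = refl

  ι-homo-+ : ∀ a b → ι (a ℕ.+ b) ≡ ι a ℚ.+ ι b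
  ι-homo-+ a b = toℚ-homo-+ (+ a) (+ b)

  ι-homo-* : ∀ a b → ι (a ℕ.* b) ≡ ι a ℚ.* ι b
  ι-homo-* a b = trans (cong toℚ (ℤₚ.pos-* a b)) (toℚ-homo-* (+ a) (+ b))

  ι-mono-≤ : ∀ {a b} → a ℕ.≤ b → ι a ℚ.≤ ι b
  ι-mono-≤ {a} {b} a≤b = toℚ-mono-≤ {+ a} {+ b} (ℤ.+≤+ a≤b)

  ι-cancel-≤ : ∀ {a b} → ι a ℚ.≤ ι b → a ℕ.≤ b
  ι-cancel-≤ {a} {b} a≤b = ℤₚ.drop‿+≤+ (toℚ-cancel-≤ {+ a} {+ b} a≤b)

  -- A nonnegative fraction is at most its numerator, the denominator being at least 1; a negative
  -- one is below 0.
  natural-upper-bound : ∀ q → ∃ λ m → q ℚ.≤ ι m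
  natural-upper-bound (mkℚ (+ m) d c) = m , subst (mkℚ (+ m) d c ℚ.≤_) (≡.sym (toℚ≡mkℚ (+ m)))
    (*≤* (ℤₚ.*-monoˡ-≤-nonNeg (+ m) (ℤ.+≤+ (s≤s z≤n))))
  natural-upper-bound q@(mkℚ -[1+ _ ] _ _) = 0 , ℚₚ.<⇒≤ (ℚₚ.negative⁻¹ q)

0≤ι : ∀ m → 0ℚ ℚ.≤ ι m
0≤ι m = subst (ℚ._≤ ι m) ι-0 (ι-mono-≤ z≤n)

ι-Σ : ∀ {n} (f : Fin n → ℕ) → ι (Σℕ f) ≡ Σℚ (λ i → ι (f i))
ι-Σ {zero} f = ι-0
ι-Σ {suc n} f = trans (ι-homo-+ (f zero) _) (cong (ι (f zero) ℚ.+_) (ι-Σ (f ∘ suc)))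

Σℚ-1 : ∀ n → Σℚ {n} (λ _ → 1ℚ) ≡ ι n
Σℚ-1 zero = ≡.sym ι-0
Σℚ-1 (suc n) = begin
  1ℚ ℚ.+ Σℚ {n} (λ _ → 1ℚ)  ≡⟨ cong₂ ℚ._+_ ι-1 (≡.sym (Σℚ-1 n)) ⟨
  ι 1 ℚ.+ ι n               ≡⟨ ι-homo-+ 1 n ⟨
  ι (suc n)                 ∎
  where open ≡-Reasoning

Σℕ-1 : ∀ n → Σℕ {n} (λ _ → 1) ≡ n
Σℕ-1 zero = refl
Σℕ-1 (suc n) = cong suc (Σℕ-1 n)

-- Extremal elements and cardinalities of finite sets.

module Selection {A : Set} {_≤_ : A → A → Set} (≤-trans : Transitive _≤_) (≤-total : Total _≤_) where

  ≤-refl : Reflexive _≤_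
  ≤-refl {x} with ≤-total x x
  ... | inj₁ x≤x = x≤x
  ... | inj₂ x≤x = x≤x

  -- An arbitrary total preorder is allowed so that the reversed order yields maximisers. The uses
  -- are the first blocking coordinate, the heaviest item, the cheapest block and the most
  -- profitable guess.
  least : ∀ {n} (f : Fin n → A) {P : Pred (Fin n) 0ℓ} → Decidable P → ∃ P →
          ∃ λ p → P p × (∀ q → P q → f p ≤ f q)
  least {suc n} f {P} P? (p , Pp) with Finₚ.any? (P? ∘ suc) | P? zero
  ... | no none | no ¬P0 = contradiction Pp (absurd p)
    where
    absurd : ∀ p → ¬ P p
    absurd zero = ¬P0
    absurd (suc q) Pq = none (q , Pq)
  ... | no none | yes P0 = zero , P0 , λ where
    zero _ → ≤-refl
    (suc q) Pq → contradiction (q , Pq) none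
  ... | yes some | no ¬P0 with least (f ∘ suc) (P? ∘ suc) some
  ...   | m , Pm , min = suc m , Pm , λ where
    zero P0 → contradiction P0 ¬P0
    (suc q) → min q
  least {suc n} f {P} P? (p , Pp) | yes some | yes P0
    with least (f ∘ suc) (P? ∘ suc) some
  ... | m , Pm , min with ≤-total (f zero) (f (suc m))
  ...   | inj₁ f0≤fm = zero , P0 , λ where
    zero _ → ≤-refl
    (suc q) Pq → ≤-trans f0≤fm (min q Pq)
  ...   | inj₂ fm≤f0 = suc m , Pm , λ where
    zero _ → fm≤f0
    (suc q) → min q

indicator : Bool → ℕ
indicator b = if b then 1 else 0

count : ∀ {n} → (Fin n → Bool) → ℕ
count F = Σℕ (indicator ∘ F)

count-positive : ∀ {n} (F : Fin n → Bool) → 0 ℕ.< count F → ∃ λ p → F p ≡ true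
count-positive {suc n} F 0<c with F zero in eq
... | true = zero , eq
... | false with count-positive (F ∘ suc) 0<c
...   | p , Fp = suc p , Fp

infixl 6 _∖_

_∖_ : ∀ {n} → (Fin n → Bool) → Fin n → Fin n → Bool
(F ∖ p) i = F i ∧ not (does (p Fin.≟ i))

∖-removed : ∀ {n} (F : Fin n → Bool) p → (F ∖ p) p ≡ false
∖-removed F p rewrite dec-true (p Fin.≟ p) refl = Boolₚ.∧-zeroʳ (F p)

∖-⊆ : ∀ {n} (F : Fin n → Bool) p i → F i ≡ false → (F ∖ p) i ≡ false
∖-⊆ F p i Fi rewrite Fi = refl

count-∖ : ∀ {n} (F : Fin n → Bool) p → count F ℕ.≤ suc (count (F ∖ p))
count-∖ F p = begin
  count F                                              ≤⟨ ℕΣ.Σ-mono (λ i → pointwise (F i) (does (p Fin.≟ i))) ⟩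
  Σℕ (λ i → ℕΣ.δ p i ℕ.+ indicator ((F ∖ p) i)) ≡⟨ ℕΣ.Σ-distrib-+ (ℕΣ.δ p) _ ⟩
  Σℕ (ℕΣ.δ p) ℕ.+ count (F ∖ p)                        ≡⟨ cong (ℕ._+ count (F ∖ p)) (ℕΣ.Σ-δ-1 p) ⟩
  suc (count (F ∖ p))                                  ∎
  where
  open ℕₚ.≤-Reasoning
  pointwise : ∀ b d → indicator b ℕ.≤ indicator d ℕ.+ indicator (b ∧ not d)
  pointwise false d = z≤n
  pointwise true true = ℕₚ.≤-refl
  pointwise true false = ℕₚ.≤-refl

-- The indicator of `G` plus the unit vector at `p` stays below the indicator of `F`. This strict
-- decrease is what makes pivoting terminate.
count-strict : ∀ {n} {F G : Fin n → Bool} → (∀ i → F i ≡ false → G i ≡ false) →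
               ∀ p → F p ≡ true → G p ≡ false → count G ℕ.< count F
count-strict {n} {F} {G} G⊆F p Fp Gp = begin
  suc (count G)                                   ≡⟨ cong (ℕ._+ count G) (ℕΣ.Σ-δ-1 p) ⟨
  Σℕ (ℕΣ.δ p) ℕ.+ count G                         ≡⟨ ℕΣ.Σ-distrib-+ (ℕΣ.δ p) _ ⟨
  Σℕ (λ i → ℕΣ.δ p i ℕ.+ indicator (G i))  ≤⟨ ℕΣ.Σ-mono pointwise ⟩
  count F                                         ∎
  where
  open ℕₚ.≤-Reasoning
  pointwise : ∀ i → ℕΣ.δ p i ℕ.+ indicator (G i) ℕ.≤ indicator (F i)
  pointwise i with p Fin.≟ i
  ... | yes refl rewrite Fp | Gp = ℕₚ.≤-refl
  ... | no _ with F i in Fi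
  ...   | false rewrite G⊆F i Fi = z≤n
  ...   | true with G i
  ...     | true = ℕₚ.≤-refl
  ...     | false = z≤n

-- Rational vectors and kernels of short systems.

*-mono-≤ˡ : ∀ {r p q} → 0ℚ ℚ.≤ r → p ℚ.≤ q → r ℚ.* p ℚ.≤ r ℚ.* q
*-mono-≤ˡ {r} 0≤r = ℚₚ.*-monoˡ-≤-nonNeg r {{ℚ.nonNegative 0≤r}}

*-mono-≤ʳ : ∀ {r p q} → 0ℚ ℚ.≤ r → p ℚ.≤ q → p ℚ.* r ℚ.≤ q ℚ.* r
*-mono-≤ʳ {r} 0≤r = ℚₚ.*-monoʳ-≤-nonNeg r {{ℚ.nonNegative 0≤r}}

*-nonneg : ∀ {p q} → 0ℚ ℚ.≤ p → 0ℚ ℚ.≤ q → 0ℚ ℚ.≤ p ℚ.* q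
*-nonneg {p} {q} 0≤p 0≤q = subst (ℚ._≤ p ℚ.* q) (ℚₚ.*-zeroʳ p) (*-mono-≤ˡ 0≤p 0≤q)

p*q≡0⇒q≡0 : ∀ {p q} → p ≢ 0ℚ → p ℚ.* q ≡ 0ℚ → q ≡ 0ℚ
p*q≡0⇒q≡0 {p} {q} p≢0 pq≡0 = begin
  q                      ≡⟨ ℚₚ.*-identityˡ q ⟨
  1ℚ ℚ.* q               ≡⟨ cong (ℚ._* q) (ℚₚ.*-inverseˡ p) ⟨
  1/ p ℚ.* p ℚ.* q       ≡⟨ ℚₚ.*-assoc (1/ p) p q ⟩
  1/ p ℚ.* (p ℚ.* q)     ≡⟨ cong (1/ p ℚ.*_) pq≡0 ⟩
  1/ p ℚ.* 0ℚ            ≡⟨ ℚₚ.*-zeroʳ (1/ p) ⟩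
  0ℚ                     ∎
  where
  open ≡-Reasoning
  instance _ = ℚ.≢-nonZero p≢0

Σ-linear : ∀ {n} a b (f g : Fin n → ℚ) →
           Σℚ (λ i → a ℚ.* f i ℚ.+ b ℚ.* g i) ≡ a ℚ.* Σℚ f ℚ.+ b ℚ.* Σℚ g
Σ-linear a b f g = trans (ℚΣ.Σ-distrib-+ (λ i → a ℚ.* f i) (λ i → b ℚ.* g i))
  (cong₂ ℚ._+_ (ℚΣ.Σ-distribˡ-* a f) (ℚΣ.Σ-distribˡ-* b g))

infix 7 _·_

_·_ : ∀ {n} → (Fin n → ℚ) → (Fin n → ℚ) → ℚ
a · x = Σℚ (λ i → a i ℚ.* x i)

·-linear : ∀ {n} (a : Fin n → ℚ) p q x y →
           a · (λ i → p ℚ.* x i ℚ.+ q ℚ.* y i) ≡ p ℚ.* (a · x) ℚ.+ q ℚ.* (a · y)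
·-linear a p q x y = trans
  (ℚΣ.Σ-cong (λ i → solve 5 (λ a p q x y → a :* (p :* x :+ q :* y) := p :* (a :* x) :+ q :* (a :* y))
                            refl (a i) p q (x i) (y i)))
  (Σ-linear p q (λ i → a i ℚ.* x i) (λ i → a i ℚ.* y i))
  where open +-*-Solver

·-move : ∀ {n} (a : Fin n → ℚ) t x v → a · (λ i → x i ℚ.+ t ℚ.* v i) ≡ a · x ℚ.+ t ℚ.* (a · v)
·-move a t x v = begin
  a · (λ i → x i ℚ.+ t ℚ.* v i)
    ≡⟨ ℚΣ.Σ-cong (λ i → cong (λ y → a i ℚ.* (y ℚ.+ t ℚ.* v i)) (≡.sym (ℚₚ.*-identityˡ (x i)))) ⟩
  a · (λ i → 1ℚ ℚ.* x i ℚ.+ t ℚ.* v i)  ≡⟨ ·-linear a 1ℚ t x v ⟩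
  1ℚ ℚ.* (a · x) ℚ.+ t ℚ.* (a · v)      ≡⟨ cong (ℚ._+ t ℚ.* (a · v)) (ℚₚ.*-identityˡ (a · x)) ⟩
  a · x ℚ.+ t ℚ.* (a · v)               ∎
  where open ≡-Reasoning

-- Elimination without division: with pivot p in the first row r, recurse on the rows r p * R i - R p * r i off p,
-- then correct the solution at p.
kernel-vector : ∀ k {n} (R : Fin k → Fin n → ℚ) (F : Fin n → Bool) → k ℕ.< count F →
                ∃ λ v → (∀ i → F i ≡ false → v i ≡ 0ℚ) × (∃ λ i → v i ≢ 0ℚ) × (∀ j → R j · v ≡ 0ℚ)
kernel-vector zero R F 0<F with count-positive F 0<F
... | p , Fp = ℚΣ.δ p
             , (λ i Fi → ℚΣ.δ-≢ {p = p} {i} (λ { refl → case trans (≡.sym Fp) Fi of λ () }))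
             , (p , λ δ≡0 → case trans (≡.sym (ℚΣ.δ-refl p)) δ≡0 of λ ())
             , λ ()
kernel-vector (suc k) {n} R F k<F
  with Finₚ.any? (λ p → (F p Boolₚ.≟ true) ×-dec ¬? (R zero p ℚ.≟ 0ℚ))
-- The first row vanishes on `F`, hence annihilates every vector supported there; only the other `k`
-- rows remain to be solved.
... | no none with kernel-vector k (R ∘ suc) F (ℕₚ.<-trans (ℕₚ.n<1+n k) k<F)
...   | v , supp , nonzero , Rv≡0 = v , supp , nonzero , λ
    { (suc j) → Rv≡0 j
    ; zero → trans (ℚΣ.Σ-cong first-row) (ℚΣ.Σ-zero {n})
    }
    where
    first-row : ∀ i → R zero i ℚ.* v i ≡ 0ℚ
    first-row i with F i in Fi | R zero i ℚ.≟ 0ℚ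
    ... | false | _ = trans (cong (R zero i ℚ.*_) (supp i Fi)) (ℚₚ.*-zeroʳ (R zero i))
    ... | true | yes r≡0 = trans (cong (ℚ._* v i) r≡0) (ℚₚ.*-zeroˡ (v i))
    ... | true | no r≢0 = contradiction (i , Fi , r≢0) none
kernel-vector (suc k) {n} R F k<F | yes (p , Fp , rp≢0)
  with kernel-vector k (λ j i → r p ℚ.* R (suc j) i ℚ.+ (ℚ.- R (suc j) p) ℚ.* r i) (F ∖ p)
                     (ℕ.s≤s⁻¹ (ℕₚ.≤-trans k<F (count-∖ F p)))
  where
  r : Fin n → ℚ
  r = R zero
... | v , supp , (q , vq≢0) , Rv≡0 = w , w-supp , (q , wq≢0) , λ
    { zero → trans (row (R zero)) (ℚ-identity (r p) s)
    ; (suc j) → begin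
      R (suc j) · w                                                ≡⟨ row (R (suc j)) ⟩
      r p ℚ.* (R (suc j) · v) ℚ.+ (ℚ.- s) ℚ.* R (suc j) p
        ≡⟨ solve 4 (λ a b c d → a :* b :+ (:- c) :* d := a :* b :+ (:- d) :* c) refl (r p) (R (suc j) · v) s (R (suc j) p) ⟩
      r p ℚ.* (R (suc j) · v) ℚ.+ (ℚ.- R (suc j) p) ℚ.* s          ≡⟨ Σ-linear (r p) (ℚ.- R (suc j) p) (λ i → R (suc j) i ℚ.* v i) (λ i → r i ℚ.* v i) ⟨
      Σℚ (λ i → r p ℚ.* (R (suc j) i ℚ.* v i) ℚ.+ (ℚ.- R (suc j) p) ℚ.* (r i ℚ.* v i))
        ≡⟨ ℚΣ.Σ-cong (λ i → solve 5 (λ a b c d e → a :* (b :* e) :+ c :* (d :* e) := (a :* b :+ c :* d) :* e) refl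
                                  (r p) (R (suc j) i) (ℚ.- R (suc j) p) (r i) (v i)) ⟩
      Σℚ (λ i → (r p ℚ.* R (suc j) i ℚ.+ (ℚ.- R (suc j) p) ℚ.* r i) ℚ.* v i) ≡⟨ Rv≡0 j ⟩
      0ℚ ∎
    }
    where
    open ≡-Reasoning
    open +-*-Solver
    r w : Fin n → ℚ
    r = R zero
    s : ℚ
    s = r · v
    w i = r p ℚ.* v i ℚ.+ (ℚ.- s) ℚ.* ℚΣ.δ p i
    row : ∀ a → a · w ≡ r p ℚ.* (a · v) ℚ.+ (ℚ.- s) ℚ.* a p
    row a = trans (·-linear a (r p) (ℚ.- s) v (ℚΣ.δ p))
      (cong (λ z → r p ℚ.* (a · v) ℚ.+ (ℚ.- s) ℚ.* z)
            (trans (ℚΣ.Σ-cong (λ i → ℚₚ.*-comm (a i) (ℚΣ.δ p i))) (ℚΣ.Σ-δ p a)))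
    ℚ-identity : ∀ a b → a ℚ.* b ℚ.+ (ℚ.- b) ℚ.* a ≡ 0ℚ
    ℚ-identity = solve 2 (λ a b → a :* b :+ (:- b) :* a := con 0ℚ) refl
    off-p : ∀ i → p ≢ i → w i ≡ r p ℚ.* v i
    off-p i p≢i = trans (cong (λ z → r p ℚ.* v i ℚ.+ (ℚ.- s) ℚ.* z) (ℚΣ.δ-≢ p≢i))
      (solve 2 (λ a b → a :+ b :* con 0ℚ := a) refl (r p ℚ.* v i) (ℚ.- s))
    w-supp : ∀ i → F i ≡ false → w i ≡ 0ℚ
    w-supp i Fi = trans (off-p i (λ { refl → case trans (≡.sym Fp) Fi of λ () }))
      (trans (cong (r p ℚ.*_) (supp i (∖-⊆ F p i Fi))) (ℚₚ.*-zeroʳ (r p)))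
    -- `v` vanishes at `p`, so `q` is another index, where the correction is invisible and `w` is
    -- `v` scaled by the nonzero pivot.
    wq≢0 : w q ≢ 0ℚ
    wq≢0 wq≡0 = vq≢0 (p*q≡0⇒q≡0 rp≢0 (trans (≡.sym (off-p q p≢q)) wq≡0))
      where
      p≢q : p ≢ q
      p≢q refl = vq≢0 (supp p (∖-removed F p))

-- Moving within a box until at most k coordinates lie strictly inside.

p≤p+q : ∀ {p q} → 0ℚ ℚ.≤ q → p ℚ.≤ p ℚ.+ q
p≤p+q {p} {q} 0≤q = subst (ℚ._≤ p ℚ.+ q) (ℚₚ.+-identityʳ p) (ℚₚ.+-monoʳ-≤ p 0≤q)

0≤q-p : ∀ {p q} → p ℚ.≤ q → 0ℚ ℚ.≤ q ℚ.- p
0≤q-p {p} {q} p≤q = subst (ℚ._≤ q ℚ.- p) (ℚₚ.+-inverseʳ p) (ℚₚ.+-monoˡ-≤ (ℚ.- p) p≤q)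

-- The ratio test of the simplex method for one coordinate: `length` is how far `x` may travel in
-- direction `v` before meeting a bound. A coordinate with `v = 0` never blocks; the premises
-- `v ≢ 0ℚ` keep its placeholder length 0 from stopping the move.
record Step (l h x v : ℚ) : Set where
  field
    length : ℚ
    nonneg : 0ℚ ℚ.≤ length
    hits   : v ≢ 0ℚ → x ℚ.+ length ℚ.* v ≡ l ⊎ x ℚ.+ length ℚ.* v ≡ h
    stays  : ∀ s → 0ℚ ℚ.≤ s → (v ≢ 0ℚ → s ℚ.≤ length) → l ℚ.≤ x ℚ.+ s ℚ.* v × x ℚ.+ s ℚ.* v ℚ.≤ h

module _ {l h x v : ℚ} (l≤x : l ℚ.≤ x) (x≤h : x ℚ.≤ h) where

  open +-*-Solver

  step-up : 0ℚ ℚ.< v → Step l h x v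
  step-up 0<v = record
    { length = t
    ; nonneg = *-nonneg (0≤q-p x≤h) (ℚₚ.<⇒≤ (ℚₚ.positive⁻¹ (1/ v) {{ℚₚ.1/pos⇒pos v}}))
    ; hits = λ _ → inj₂ reaches
    ; stays = λ s 0≤s s≤t →
        ℚₚ.≤-trans l≤x (p≤p+q (*-nonneg 0≤s (ℚₚ.<⇒≤ 0<v))) ,
        subst (x ℚ.+ s ℚ.* v ℚ.≤_) reaches
              (ℚₚ.+-monoʳ-≤ x (*-mono-≤ʳ (ℚₚ.<⇒≤ 0<v) (s≤t (λ v≡0 → ℚₚ.<⇒≢ 0<v (≡.sym v≡0)))))
    }
    where
    instance
      _ = ℚ.positive 0<v
      _ = ℚₚ.pos⇒nonZero v
    t : ℚ
    t = (h ℚ.- x) ℚ.* 1/ v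
    reaches : x ℚ.+ t ℚ.* v ≡ h
    reaches = begin
      x ℚ.+ (h ℚ.- x) ℚ.* 1/ v ℚ.* v    ≡⟨ solve 4 (λ a b c d → a :+ (b :- a) :* c :* d := a :+ (b :- a) :* (c :* d)) refl x h (1/ v) v ⟩
      x ℚ.+ (h ℚ.- x) ℚ.* (1/ v ℚ.* v)  ≡⟨ cong (λ o → x ℚ.+ (h ℚ.- x) ℚ.* o) (ℚₚ.*-inverseˡ v) ⟩
      x ℚ.+ (h ℚ.- x) ℚ.* 1ℚ            ≡⟨ solve 2 (λ a b → a :+ (b :- a) :* con 1ℚ := b) refl x h ⟩
      h                                 ∎
      where open ≡-Reasoning

  step-still : v ≡ 0ℚ → Step l h x v
  step-still v≡0 = record
    { length = 0ℚ
    ; nonneg = ℚₚ.≤-refl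
    ; hits = λ v≢0 → contradiction v≡0 v≢0
    ; stays = λ s _ _ → subst (l ℚ.≤_) (≡.sym (fixed s)) l≤x , subst (ℚ._≤ h) (≡.sym (fixed s)) x≤h
    }
    where
    fixed : ∀ s → x ℚ.+ s ℚ.* v ≡ x
    fixed s = trans (cong (λ z → x ℚ.+ s ℚ.* z) v≡0) (solve 2 (λ a b → a :+ b :* con 0ℚ := a) refl x s)

-- Negation exchanges the two bounds, which reduces a negative direction to a positive one.
step-reflect : ∀ {l h x v} → Step (ℚ.- h) (ℚ.- l) (ℚ.- x) (ℚ.- v) → Step l h x v
step-reflect {l} {h} {x} {v} st = record
  { length = length
  ; nonneg = nonneg
  ; hits = λ v≢0 → case hits (v≢0 ∘ ℚₚ.neg-injective) of λ
      { (inj₁ eq) → inj₂ (ℚₚ.neg-injective (trans (moved length) eq))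
      ; (inj₂ eq) → inj₁ (ℚₚ.neg-injective (trans (moved length) eq))
      }
  ; stays = λ s 0≤s s≤t → let (above , below) = stays s 0≤s (λ -v≢0 → s≤t (-v≢0 ∘ cong (ℚ.-_))) in
      neg-cancel (subst (ℚ._≤ ℚ.- l) (≡.sym (moved s)) below) ,
      neg-cancel (subst (ℚ.- h ℚ.≤_) (≡.sym (moved s)) above)
  }
  where
  open Step st
  open +-*-Solver
  moved : ∀ s → ℚ.- (x ℚ.+ s ℚ.* v) ≡ ℚ.- x ℚ.+ s ℚ.* (ℚ.- v)
  moved s = solve 3 (λ x s v → :- (x :+ s :* v) := :- x :+ s :* (:- v)) refl x s v
  neg-involutive : ∀ q → ℚ.- (ℚ.- q) ≡ q
  neg-involutive = solve 1 (λ q → :- (:- q) := q) refl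
  neg-cancel : ∀ {p q} → ℚ.- p ℚ.≤ ℚ.- q → q ℚ.≤ p
  neg-cancel {p} {q} -p≤-q = subst₂ ℚ._≤_ (neg-involutive q) (neg-involutive p) (ℚₚ.neg-antimono-≤ -p≤-q)

step : ∀ {l h x} v → l ℚ.≤ x → x ℚ.≤ h → Step l h x v
step v l≤x x≤h with ℚₚ.<-cmp v 0ℚ
... | tri< v<0 _ _ = step-reflect (step-up (ℚₚ.neg-antimono-≤ x≤h) (ℚₚ.neg-antimono-≤ l≤x) (ℚₚ.neg-antimono-< v<0))
... | tri≈ _ v≡0 _ = step-still l≤x x≤h v≡0
... | tri> _ _ 0<v = step-up l≤x x≤h 0<v

does-true⇒ : {P : Set} (d : Dec P) → does d ≡ true → P
does-true⇒ (yes p) _ = p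

does-false⇒¬ : {P : Set} (d : Dec P) → does d ≡ false → ¬ P
does-false⇒¬ (no ¬p) _ = ¬p

module _ {k n : ℕ} (R : Fin k → Fin n → ℚ) (c lo hi : Fin n → ℚ) where

  InBox : (Fin n → ℚ) → Set
  InBox x = ∀ i → lo i ℚ.≤ x i × x i ℚ.≤ hi i

  opaque
    inside? : ∀ (x : Fin n → ℚ) i → Dec (lo i ℚ.< x i × x i ℚ.< hi i)
    inside? x i = (lo i ℚ.<? x i) ×-dec (x i ℚ.<? hi i)

  strictlyInside : (Fin n → ℚ) → Fin n → Bool
  strictlyInside x i = does (inside? x i)

  strictlyInside-false : ∀ {x} → InBox x → ∀ i → strictlyInside x i ≡ false → x i ≡ lo i ⊎ x i ≡ hi i
  strictlyInside-false {x} box i eq with x i ℚ.≤? lo i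
  ... | yes x≤lo = inj₁ (ℚₚ.≤-antisym x≤lo (proj₁ (box i)))
  ... | no x≰lo = inj₂ (ℚₚ.≤-antisym (proj₂ (box i))
    (ℚₚ.≮⇒≥ (λ x<hi → does-false⇒¬ (inside? x i) eq (ℚₚ.≰⇒> x≰lo , x<hi))))

  strictlyInside-lo : ∀ {x i} → x i ≡ lo i → strictlyInside x i ≡ false
  strictlyInside-lo {x} {i} eq = dec-false (inside? x i) (ℚₚ.<-irrefl (≡.sym eq) ∘ proj₁)

  strictlyInside-hi : ∀ {x i} → x i ≡ hi i → strictlyInside x i ≡ false
  strictlyInside-hi {x} {i} eq = dec-false (inside? x i) (ℚₚ.<-irrefl eq ∘ proj₂)

  strictlyInside-true : ∀ {x i} → strictlyInside x i ≡ true → lo i ℚ.< hi i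
  strictlyInside-true {x} {i} eq = ℚₚ.<-trans (proj₁ inside) (proj₂ inside)
    where
    inside : lo i ℚ.< x i × x i ℚ.< hi i
    inside = does-true⇒ (inside? x i) eq

  -- The kernel is closed under negation, so the sign of `v` can be chosen to make `c · v`
  -- nonnegative.
  improving-direction : ∀ F → k ℕ.< count F →
    ∃ λ v → (∀ i → F i ≡ false → v i ≡ 0ℚ) × (∃ λ i → v i ≢ 0ℚ) × (∀ j → R j · v ≡ 0ℚ) × 0ℚ ℚ.≤ c · v
  improving-direction F k<F with kernel-vector k R F k<F
  ... | v , supp , (q , vq≢0) , Rv≡0 with ℚₚ.≤-total 0ℚ (c · v)
  ...   | inj₁ 0≤cv = v , supp , (q , vq≢0) , Rv≡0 , 0≤cv
  ...   | inj₂ cv≤0 = (λ i → ℚ.- v i)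
                    , (λ i Fi → cong (ℚ.-_) (supp i Fi))
                    , (q , vq≢0 ∘ ℚₚ.neg-injective)
                    , (λ j → trans (·-neg (R j)) (cong (ℚ.-_) (Rv≡0 j)))
                    , subst (0ℚ ℚ.≤_) (≡.sym (·-neg c)) (ℚₚ.neg-antimono-≤ cv≤0)
    where
    ·-neg : ∀ a → a · (λ i → ℚ.- v i) ≡ ℚ.- (a · v)
    ·-neg a = begin
      a · (λ i → ℚ.- v i)                      ≡⟨ ℚΣ.Σ-cong (λ i → solve 2 (λ a v → a :* (:- v) := (:- con 1ℚ) :* (a :* v)) refl (a i) (v i)) ⟩
      Σℚ (λ i → (ℚ.- 1ℚ) ℚ.* (a i ℚ.* v i))    ≡⟨ ℚΣ.Σ-distribˡ-* (ℚ.- 1ℚ) (λ i → a i ℚ.* v i) ⟩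
      (ℚ.- 1ℚ) ℚ.* (a · v)                     ≡⟨ solve 1 (λ s → (:- con 1ℚ) :* s := :- s) refl (a · v) ⟩
      ℚ.- (a · v)                              ∎
      where
      open ≡-Reasoning
      open +-*-Solver

  -- Coordinates already on a bound stay put, because the direction is supported on the strictly
  -- inside ones; the first coordinate to block lands on a bound and leaves that set.
  pivot : ∀ {x} → InBox x → k ℕ.< count (strictlyInside x) →
    ∃ λ x′ → InBox x′ × (∀ j → R j · x′ ≡ R j · x) × c · x ℚ.≤ c · x′ ×
             count (strictlyInside x′) ℕ.< count (strictlyInside x)
  pivot {x} box k<F = along (improving-direction (strictlyInside x) k<F)
    where
    x+0 : ∀ y t z → z ≡ 0ℚ → y ℚ.+ t ℚ.* z ≡ y
    x+0 y t z z≡0 = trans (cong (λ z → y ℚ.+ t ℚ.* z) z≡0)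
      (solve 2 (λ a b → a :+ b :* con 0ℚ := a) refl y t)
      where open +-*-Solver
    module _ (v : Fin n → ℚ) (supp : ∀ i → strictlyInside x i ≡ false → v i ≡ 0ℚ)
             (Rv≡0 : ∀ j → R j · v ≡ 0ℚ) (0≤cv : 0ℚ ℚ.≤ c · v)
             (steps : ∀ i → Step (lo i) (hi i) (x i) (v i))
             (p : Fin n) (vp≢0 : v p ≢ 0ℚ)
             (first : ∀ q → v q ≢ 0ℚ → Step.length (steps p) ℚ.≤ Step.length (steps q))
             where
      t : ℚ
      t = Step.length (steps p)
      x′ : Fin n → ℚ
      x′ i = x i ℚ.+ t ℚ.* v i
      still : ∀ i → strictlyInside x i ≡ false → x′ i ≡ x i
      still i Fi = x+0 (x i) t (v i) (supp i Fi)
      shrinks : ∀ i → strictlyInside x i ≡ false → strictlyInside x′ i ≡ false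
      shrinks i Fi with strictlyInside-false box i Fi
      ... | inj₁ eq = strictlyInside-lo {x′} (trans (still i Fi) eq)
      ... | inj₂ eq = strictlyInside-hi {x′} (trans (still i Fi) eq)
      hit : strictlyInside x′ p ≡ false
      hit with Step.hits (steps p) vp≢0
      ... | inj₁ eq = strictlyInside-lo {x′} eq
      ... | inj₂ eq = strictlyInside-hi {x′} eq
      inside : strictlyInside x p ≡ true
      inside with strictlyInside x p in Fp
      ... | true = refl
      ... | false = contradiction (supp p Fp) vp≢0
      moved : ∃ λ x′ → InBox x′ × (∀ j → R j · x′ ≡ R j · x) × c · x ℚ.≤ c · x′ ×
                       count (strictlyInside x′) ℕ.< count (strictlyInside x)
      moved = x′
            , (λ i → Step.stays (steps i) t (Step.nonneg (steps p)) (first i))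
            , (λ j → trans (·-move (R j) t x v) (x+0 (R j · x) t (R j · v) (Rv≡0 j)))
            , subst (c · x ℚ.≤_) (≡.sym (·-move c t x v)) (p≤p+q (*-nonneg (Step.nonneg (steps p)) 0≤cv))
            , count-strict shrinks p inside hit
    along : (∃ λ v → (∀ i → strictlyInside x i ≡ false → v i ≡ 0ℚ) × (∃ λ i → v i ≢ 0ℚ) ×
                     (∀ j → R j · v ≡ 0ℚ) × 0ℚ ℚ.≤ c · v) → _
    along (v , supp , some , Rv≡0 , 0≤cv) =
      let steps = λ i → step (v i) (proj₁ (box i)) (proj₂ (box i))
          -- The minimum runs over the moving coordinates only, so the step keeps all of them in the
          -- box and brings `p` to a bound.
          (p , vp≢0 , first) = Selection.least ℚₚ.≤-trans ℚₚ.≤-total (λ i → Step.length (steps i))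
                                                (λ i → ¬? (v i ℚ.≟ 0ℚ)) some
      in moved v supp Rv≡0 0≤cv steps p vp≢0 first

  -- Keeping each `R j · x` equal, rather than below a capacity, leaves the bounds of the box as the
  -- only constraints that can become tight; hence the count k.
  NearlyVertex : (Fin n → ℚ) → Set
  NearlyVertex x = ∃ λ x′ → InBox x′ × (∀ j → R j · x′ ≡ R j · x) × c · x ℚ.≤ c · x′ ×
                            count (strictlyInside x′) ℕ.≤ k

  -- Pivoting is repeated while more than `k` coordinates are strictly inside; `m` bounds their
  -- number and drives the recursion.
  nearly-vertex : ∀ {x} → InBox x → NearlyVertex x
  nearly-vertex {x} box = go (count (strictlyInside x)) x box ℕₚ.≤-refl
    where
    go : ∀ m x → InBox x → count (strictlyInside x) ℕ.≤ m → NearlyVertex x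
    improve : ∀ m x → InBox x → count (strictlyInside x) ℕ.≤ m → k ℕ.< count (strictlyInside x) → NearlyVertex x
    go m x box F≤m = case ℕₚ.≤-<-connex (count (strictlyInside x)) k of λ
      { (inj₁ F≤k) → x , box , (λ _ → refl) , ℚₚ.≤-refl , F≤k
      ; (inj₂ k<F) → improve m x box F≤m k<F
      }
    improve zero x box F≤0 k<F = contradiction (ℕₚ.<-≤-trans k<F F≤0) λ ()
    improve (suc m) x box F≤m k<F =
      let (y , box-y , Ry , cy , F<) = pivot box k<F
          (z , box-z , Rz , cz , F≤k) = go m y box-y (ℕ.s≤s⁻¹ (ℕₚ.≤-trans F< F≤m))
      in z , box-z , (λ j → trans (Rz j) (Ry j)) , ℚₚ.≤-trans cy cz , F≤k

-- Rounding up the few fractional coordinates.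

-- The search descends from the known bound `m`; the conclusion `z ≤ m` is what keeps a rounded
-- coordinate inside its box.
ceiling : ∀ {x} m → 0ℚ ℚ.≤ x → x ℚ.≤ ι m → ∃ λ z → z ℕ.≤ m × x ℚ.≤ ι z × ι z ℚ.≤ x ℚ.+ 1ℚ
ceiling {x} zero 0≤x x≤0 = 0 , z≤n , x≤0 ,
  ℚₚ.≤-trans (ℚₚ.≤-reflexive ι-0) (ℚₚ.≤-trans 0≤x (p≤p+q (ℚₚ.nonNegative⁻¹ 1ℚ)))
ceiling {x} (suc m) 0≤x x≤m+1 with x ℚ.≤? ι m
... | yes x≤m with ceiling m 0≤x x≤m
...   | z , z≤m , x≤z , z≤x+1 = z , ℕₚ.m≤n⇒m≤1+n z≤m , x≤z , z≤x+1
ceiling {x} (suc m) 0≤x x≤m+1 | no x≰m = suc m , ℕₚ.≤-refl , x≤m+1 , (begin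
  ι (suc m)      ≡⟨ ι-homo-+ 1 m ⟩
  ι 1 ℚ.+ ι m    ≡⟨ cong (ℚ._+ ι m) ι-1 ⟩
  1ℚ ℚ.+ ι m     ≡⟨ ℚₚ.+-comm 1ℚ (ι m) ⟩
  ι m ℚ.+ 1ℚ     ≤⟨ ℚₚ.+-monoˡ-≤ 1ℚ (ℚₚ.<⇒≤ (ℚₚ.≰⇒> x≰m)) ⟩
  x ℚ.+ 1ℚ       ∎)
  where open ℚₚ.≤-Reasoning

infix 7 _·ℕ_

_·ℕ_ : ∀ {n} → (Fin n → ℕ) → (Fin n → ℕ) → ℕ
a ·ℕ z = Σℕ (λ i → a i ℕ.* z i)

ι-· : ∀ {n} (a z : Fin n → ℕ) → ι (a ·ℕ z) ≡ (ι ∘ a) · (ι ∘ z)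
ι-· a z = trans (ι-Σ (λ i → a i ℕ.* z i)) (ℚΣ.Σ-cong (λ i → ι-homo-* (a i) (z i)))

·-mono : ∀ {n} {c x y : Fin n → ℚ} → (∀ i → 0ℚ ℚ.≤ c i) → (∀ i → x i ℚ.≤ y i) → c · x ℚ.≤ c · y
·-mono 0≤c x≤y = ℚΣ.Σ-mono (λ i → *-mono-≤ˡ (0≤c i) (x≤y i))

·-nonneg : ∀ {n} {c x : Fin n → ℚ} → (∀ i → 0ℚ ℚ.≤ c i) → (∀ i → 0ℚ ℚ.≤ x i) → 0ℚ ℚ.≤ c · x
·-nonneg 0≤c 0≤x = ℚΣ.Σ-nonneg (λ i → *-nonneg (0≤c i) (0≤x i))

·-distrib-+ : ∀ {n} (c x y : Fin n → ℚ) → c · (λ i → x i ℚ.+ y i) ≡ c · x ℚ.+ c · y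
·-distrib-+ c x y = trans (ℚΣ.Σ-cong (λ i → ℚₚ.*-distribˡ-+ (c i) (x i) (y i)))
  (ℚΣ.Σ-distrib-+ (λ i → c i ℚ.* x i) (λ i → c i ℚ.* y i))

·-Σ : ∀ {m n} (c : Fin n → ℚ) (X : Fin m → Fin n → ℚ) → c · (λ i → Σℚ (λ σ → X σ i)) ≡ Σℚ (λ σ → c · X σ)
·-Σ c X = trans (ℚΣ.Σ-cong (λ i → ≡.sym (ℚΣ.Σ-distribˡ-* (c i) (λ σ → X σ i))))
  (ℚΣ.Σ-swap (λ i σ → c i ℚ.* X σ i))

-- Coordinates on a bound are integral already. Rounding up the others, which form `F`, adds at most
-- `A j i` to row `j` for each `i` in `F` and cannot lower the profit. The fact `lo i < hi i` on `F`
-- is recorded because it later limits the weight of the rounded items.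
integral-rounding : ∀ {k n} (A : Fin k → Fin n → ℕ) (b : Fin k → ℕ) (lo hi : Fin n → ℕ) (c x : Fin n → ℚ) →
  (∀ i → 0ℚ ℚ.≤ c i) → (∀ i → ι (lo i) ℚ.≤ x i × x i ℚ.≤ ι (hi i)) → (∀ j → (ι ∘ A j) · x ℚ.≤ ι (b j)) →
  ∃ λ z → ∃ λ F → (∀ i → lo i ℕ.≤ z i × z i ℕ.≤ hi i) × count F ℕ.≤ k × (∀ i → F i ≡ true → lo i ℕ.< hi i) ×
    (∀ j → A j ·ℕ z ℕ.≤ b j ℕ.+ A j ·ℕ (indicator ∘ F)) × c · x ℚ.≤ c · (ι ∘ z)
integral-rounding {k} {n} A b lo hi c x 0≤c box cap
  with nearly-vertex (λ j i → ι (A j i)) c (ι ∘ lo) (ι ∘ hi) {x} box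
... | y , box-y , Ay≡Ax , cx≤cy , F≤k =
    (λ i → proj₁ (rounded i)) , F , (λ i → proj₁ (proj₂ (rounded i))) , F≤k , lo<hi , capacity
  , ℚₚ.≤-trans cx≤cy (·-mono 0≤c (λ i → proj₁ (proj₂ (proj₂ (rounded i)))))
  where
  F : Fin n → Bool
  F = strictlyInside (λ j i → ι (A j i)) c (ι ∘ lo) (ι ∘ hi) y
  lo<hi : ∀ i → F i ≡ true → lo i ℕ.< hi i
  lo<hi i Fi = ℕₚ.≰⇒> (λ hi≤lo → ℚₚ.<-irrefl refl (ℚₚ.<-≤-trans
    (strictlyInside-true (λ j i → ι (A j i)) c (ι ∘ lo) (ι ∘ hi) {y} Fi) (ι-mono-≤ hi≤lo)))
  lo≤hi : ∀ i → lo i ℕ.≤ hi i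
  lo≤hi i = ι-cancel-≤ (ℚₚ.≤-trans (proj₁ (box i)) (proj₂ (box i)))
  rounded : ∀ i → ∃ λ z → (lo i ℕ.≤ z × z ℕ.≤ hi i) × y i ℚ.≤ ι z × ι z ℚ.≤ y i ℚ.+ ι (indicator (F i))
  rounded i with F i in Fi
  ... | true with ceiling (hi i) (ℚₚ.≤-trans (0≤ι (lo i)) (proj₁ (box-y i))) (proj₂ (box-y i))
  ...   | z , z≤hi , y≤z , z≤y+1 = z , (ι-cancel-≤ (ℚₚ.≤-trans (proj₁ (box-y i)) y≤z) , z≤hi) , y≤z
                                 , subst (λ o → ι z ℚ.≤ y i ℚ.+ o) (≡.sym ι-1) z≤y+1
  rounded i | false with strictlyInside-false (λ j i → ι (A j i)) c (ι ∘ lo) (ι ∘ hi) box-y i Fi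
  ... | inj₁ y≡lo = lo i , (ℕₚ.≤-refl , lo≤hi i) , ℚₚ.≤-reflexive y≡lo
                  , ℚₚ.≤-trans (ℚₚ.≤-reflexive (≡.sym y≡lo)) (p≤p+q (0≤ι 0))
  ... | inj₂ y≡hi = hi i , (lo≤hi i , ℕₚ.≤-refl) , ℚₚ.≤-reflexive y≡hi
                  , ℚₚ.≤-trans (ℚₚ.≤-reflexive (≡.sym y≡hi)) (p≤p+q (0≤ι 0))
  z : Fin n → ℕ
  z i = proj₁ (rounded i)
  capacity : ∀ j → A j ·ℕ z ℕ.≤ b j ℕ.+ A j ·ℕ (indicator ∘ F)
  capacity j = ι-cancel-≤ (begin
    ι (A j ·ℕ z)                                           ≡⟨ ι-· (A j) z ⟩
    (ι ∘ A j) · (ι ∘ z)                                    ≤⟨ ·-mono (λ i → 0≤ι (A j i)) (λ i → proj₂ (proj₂ (proj₂ (rounded i)))) ⟩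
    (ι ∘ A j) · (λ i → y i ℚ.+ ι (indicator (F i)))        ≡⟨ ·-distrib-+ (ι ∘ A j) y (ι ∘ indicator ∘ F) ⟩
    (ι ∘ A j) · y ℚ.+ (ι ∘ A j) · (ι ∘ indicator ∘ F)
      ≡⟨ cong₂ ℚ._+_ (Ay≡Ax j) (≡.sym (ι-· (A j) (indicator ∘ F))) ⟩
    (ι ∘ A j) · x ℚ.+ ι (A j ·ℕ (indicator ∘ F))           ≤⟨ ℚₚ.+-monoˡ-≤ (ι (A j ·ℕ (indicator ∘ F))) (cap j) ⟩
    ι (b j) ℚ.+ ι (A j ·ℕ (indicator ∘ F))                 ≡⟨ ι-homo-+ (b j) _ ⟨
    ι (b j ℕ.+ A j ·ℕ (indicator ∘ F))                     ∎)
    where open ℚₚ.≤-Reasoning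

-- Multisets of heaviest units and their blocks.

-- A guessed unit is an index suc i of an item, or the dummy zero of weight 0 that pads short guesses.
choice : ∀ {n} → Fin (suc n) → Fin n → ℕ
choice zero i = 0
choice (suc p) i = ℕΣ.δ p i

weight : ∀ {n} → (Fin n → ℕ) → Fin (suc n) → ℕ
weight a zero = 0
weight a (suc p) = a p

multiplicity : ∀ {γ n} → (Fin γ → Fin (suc n)) → Fin n → ℕ
multiplicity S i = Σℕ (λ s → choice (S s) i)

·ℕ-choice : ∀ {n} (a : Fin n → ℕ) s → a ·ℕ choice s ≡ weight a s
·ℕ-choice {n} a zero = trans (ℕΣ.Σ-cong (λ i → ℕₚ.*-zeroʳ (a i))) (ℕΣ.Σ-zero {n})
·ℕ-choice a (suc p) = trans (ℕΣ.Σ-cong (λ i → ℕₚ.*-comm (a i) (ℕΣ.δ p i))) (ℕΣ.Σ-δ p a)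

·ℕ-multiplicity : ∀ {γ n} (a : Fin n → ℕ) (S : Fin γ → Fin (suc n)) →
                  a ·ℕ multiplicity S ≡ Σℕ (λ s → weight a (S s))
·ℕ-multiplicity a S = begin
  a ·ℕ multiplicity S                               ≡⟨ ℕΣ.Σ-cong (λ i → ℕΣ.Σ-distribˡ-* (a i) (λ s → choice (S s) i)) ⟨
  Σℕ (λ i → Σℕ (λ s → a i ℕ.* choice (S s) i))      ≡⟨ ℕΣ.Σ-swap (λ i s → a i ℕ.* choice (S s) i) ⟩
  Σℕ (λ s → a ·ℕ choice (S s))                      ≡⟨ ℕΣ.Σ-cong (λ s → ·ℕ-choice a (S s)) ⟩
  Σℕ (λ s → weight a (S s))                         ∎
  where open ≡-Reasoning

-- Greedy choice: take one unit of a heaviest item present, then continue with the remainder. An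
-- item heavier than that unit is absent from `z`; for later units the claim is inherited from the
-- remainder.
heaviest : ∀ γ {n} (a z : Fin n → ℕ) → ∃ λ (S : Fin γ → Fin (suc n)) →
  (∀ i → multiplicity S i ℕ.≤ z i) × (∀ i → (∃ λ s → weight a (S s) ℕ.< a i) → z i ℕ.≤ multiplicity S i)
heaviest zero a z = (λ ()) , (λ i → z≤n) , λ { i (() , _) }
heaviest (suc γ) {n} a z with Finₚ.any? (λ i → 1 ℕ.≤? z i)
-- `z` is exhausted: the remaining units are dummies, and `z i = 0` settles the second claim.
... | no none = (λ _ → zero)
              , (λ i → ℕₚ.≤-trans (ℕₚ.≤-reflexive (ℕΣ.Σ-zero {suc γ})) z≤n)
              , (λ i _ → ℕₚ.≤-trans (ℕₚ.≮⇒≥ (λ 0<z → none (i , 0<z))) z≤n)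
... | yes some
  with Selection.least {_≤_ = λ x y → y ℕ.≤ x} (λ p q → ℕₚ.≤-trans q p) (λ x y → ℕₚ.≤-total y x)
                       a (λ i → 1 ℕ.≤? z i) some
...   | p , 0<zp , heavy with heaviest γ a (λ i → z i ℕ.∸ ℕΣ.δ p i)
...     | S , S≤z , full = T , below , above
  where
  T : Fin (suc γ) → Fin (suc n)
  T zero = suc p
  T (suc s) = S s
  δ≤z : ∀ i → ℕΣ.δ p i ℕ.≤ z i
  δ≤z i with p Fin.≟ i
  ... | yes refl = 0<zp
  ... | no _ = z≤n
  below : ∀ i → ℕΣ.δ p i ℕ.+ multiplicity S i ℕ.≤ z i
  below i = ℕₚ.≤-trans (ℕₚ.+-monoʳ-≤ (ℕΣ.δ p i) (S≤z i)) (ℕₚ.≤-reflexive (ℕₚ.m+[n∸m]≡n (δ≤z i)))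
  above : ∀ i → (∃ λ s → weight a (T s) ℕ.< a i) →
          z i ℕ.≤ ℕΣ.δ p i ℕ.+ multiplicity S i
  above i (zero , lighter) = ℕₚ.≤-trans (ℕₚ.≮⇒≥ (λ 0<zi → ℕₚ.<⇒≱ lighter (heavy i 0<zi))) z≤n
  above i (suc s , lighter) = ℕₚ.≤-trans (ℕₚ.m≤n+m∸n (z i) (ℕΣ.δ p i))
    (ℕₚ.+-monoʳ-≤ (ℕΣ.δ p i) (full i (s , lighter)))

-- Both sides are compared with `k` copies of the largest weight in `F`, which avoids matching the
-- elements of `F` with indices of `w`.
·ℕ-indicator-≤ : ∀ {k n} (a : Fin n → ℕ) F (w : Fin k → ℕ) → count F ℕ.≤ k →
                 (∀ i → F i ≡ true → ∀ t → a i ℕ.≤ w t) → a ·ℕ (indicator ∘ F) ℕ.≤ Σℕ w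
·ℕ-indicator-≤ {k} {n} a F w F≤k a≤w with Finₚ.any? (λ i → F i Boolₚ.≟ true)
... | no none = ℕₚ.≤-trans (ℕₚ.≤-reflexive (trans (ℕΣ.Σ-cong vanishes) (ℕΣ.Σ-zero {n}))) z≤n
  where
  vanishes : ∀ i → a i ℕ.* indicator (F i) ≡ 0
  vanishes i with F i in Fi
  ... | true = contradiction (i , Fi) none
  ... | false = ℕₚ.*-zeroʳ (a i)
... | yes some
  with Selection.least {_≤_ = λ x y → y ℕ.≤ x} (λ p q → ℕₚ.≤-trans q p) (λ x y → ℕₚ.≤-total y x)
                       a (λ i → F i Boolₚ.≟ true) some
...   | p , Fp , heaviest-in-F = begin
  a ·ℕ (indicator ∘ F)                 ≤⟨ ℕΣ.Σ-mono bound ⟩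
  Σℕ (λ i → a p ℕ.* indicator (F i))   ≡⟨ ℕΣ.Σ-distribˡ-* (a p) (indicator ∘ F) ⟩
  a p ℕ.* count F                      ≤⟨ ℕₚ.*-monoʳ-≤ (a p) F≤k ⟩
  a p ℕ.* k                            ≡⟨ ℕₚ.*-comm (a p) k ⟩
  k ℕ.* a p                            ≡⟨ cong (ℕ._* a p) (Σℕ-1 k) ⟨
  Σℕ {k} (λ _ → 1) ℕ.* a p             ≡⟨ ℕΣ.Σ-const {k} (a p) ⟨
  Σℕ {k} (λ _ → a p)                   ≤⟨ ℕΣ.Σ-mono (a≤w p Fp) ⟩
  Σℕ w                                 ∎
  where
  open ℕₚ.≤-Reasoning
  bound : ∀ i → a i ℕ.* indicator (F i) ℕ.≤ a p ℕ.* indicator (F i)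
  bound i with F i in Fi
  ... | true = ℕₚ.*-monoˡ-≤ 1 (heaviest-in-F i Fi)
  ... | false = ℕₚ.≤-trans (ℕₚ.≤-reflexive (ℕₚ.*-zeroʳ (a i))) z≤n

block : ∀ {g k n} → (Fin (g ℕ.* k) → Fin (suc n)) → Fin g → Fin k → Fin (suc n)
block S β t = S (combine β t)

multiplicity-blocks : ∀ {g k n} (S : Fin (g ℕ.* k) → Fin (suc n)) i →
                      multiplicity S i ≡ Σℕ (λ β → multiplicity (block {g} {k} S β) i)
multiplicity-blocks {g} {k} S i = ℕΣ.Σ-combine g {k} (λ s → choice (S s) i)

block-≤ : ∀ {g k n} (S : Fin (g ℕ.* k) → Fin (suc n)) β i →
          multiplicity (block {g} {k} S β) i ℕ.≤ multiplicity S i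
block-≤ {g} {k} S β i = ℕₚ.≤-trans (ℕΣ.Σ-term-≤ {f = λ β → multiplicity (block {g} {k} S β) i} (λ _ → z≤n) β)
  (ℕₚ.≤-reflexive (≡.sym (multiplicity-blocks {g} {k} S i)))

-- The blocks partition the units of `S`, so the cheapest costs at most the average. The factor
-- `suc g` stands on the left in place of a division.
cheap-block : ∀ {g k n} (c : Fin n → ℚ) (S : Fin (suc g ℕ.* k) → Fin (suc n)) →
  ∃ λ β → ι (suc g) ℚ.* (c · (ι ∘ multiplicity (block {suc g} {k} S β))) ℚ.≤ c · (ι ∘ multiplicity S)
cheap-block {g} {k} c S = β , (begin
  ι (suc g) ℚ.* cost β                            ≡⟨ cong (ℚ._* cost β) (Σℚ-1 (suc g)) ⟨
  Σℚ {suc g} (λ _ → 1ℚ) ℚ.* cost β                ≡⟨ ℚΣ.Σ-const {suc g} (cost β) ⟨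
  Σℚ {suc g} (λ _ → cost β)                       ≤⟨ ℚΣ.Σ-mono (λ β′ → proj₂ (proj₂ cheapest) β′ tt) ⟩
  Σℚ cost                                         ≡⟨ ·-Σ c (λ β → ι ∘ multiplicity (block {suc g} {k} S β)) ⟨
  c · (λ i → Σℚ (λ β → ι (multiplicity (block {suc g} {k} S β) i)))
    ≡⟨ ℚΣ.Σ-cong (λ i → cong (c i ℚ.*_) (trans (cong ι (multiplicity-blocks {suc g} {k} S i))
                                               (ι-Σ (λ β → multiplicity (block {suc g} {k} S β) i)))) ⟨
  c · (ι ∘ multiplicity S)                        ∎)
  where
  open ℚₚ.≤-Reasoning
  cost : Fin (suc g) → ℚ
  cost β = c · (ι ∘ multiplicity (block {suc g} {k} S β))
  cheapest : ∃ λ β → ⊤ × (∀ β′ → ⊤ → cost β ℚ.≤ cost β′)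
  cheapest = Selection.least ℚₚ.≤-trans ℚₚ.≤-total cost (λ _ → yes tt) (zero , tt)
  β : Fin (suc g)
  β = proj₁ cheapest

-- The box determined by a guess.

⋁ : ∀ {k} → (Fin k → ℕ) → ℕ
⋁ {zero} f = 0
⋁ {suc k} f = f zero ℕ.⊔ ⋁ (f ∘ suc)

f≤⋁ : ∀ {k} (f : Fin k → ℕ) j → f j ℕ.≤ ⋁ f
f≤⋁ f zero = ℕₚ.m≤m⊔n (f zero) _
f≤⋁ f (suc j) = ℕₚ.≤-trans (f≤⋁ (f ∘ suc) j) (ℕₚ.m≤n⊔m (f zero) _)

⋁-least : ∀ {k} (f : Fin k → ℕ) {u} → (∀ j → f j ℕ.≤ u) → ⋁ f ℕ.≤ u
⋁-least {zero} f f≤u = z≤n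
⋁-least {suc k} f f≤u = ℕₚ.⊔-lub (f≤u zero) (⋁-least (f ∘ suc) (f≤u ∘ suc))

⋀ : ∀ {k} → ℕ → (Fin k → ℕ) → ℕ
⋀ {zero} u f = u
⋀ {suc k} u f = f zero ℕ.⊓ ⋀ u (f ∘ suc)

⋀≤u : ∀ {k} u (f : Fin k → ℕ) → ⋀ u f ℕ.≤ u
⋀≤u {zero} u f = ℕₚ.≤-refl
⋀≤u {suc k} u f = ℕₚ.≤-trans (ℕₚ.m⊓n≤n (f zero) _) (⋀≤u u (f ∘ suc))

⋀≤f : ∀ {k} u (f : Fin k → ℕ) j → ⋀ u f ℕ.≤ f j
⋀≤f u f zero = ℕₚ.m⊓n≤m (f zero) _
⋀≤f u f (suc j) = ℕₚ.≤-trans (ℕₚ.m⊓n≤n (f zero) _) (⋀≤f u (f ∘ suc) j)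

⋀-greatest : ∀ {k} u (f : Fin k → ℕ) {l} → l ℕ.≤ u → (∀ j → l ℕ.≤ f j) → l ℕ.≤ ⋀ u f
⋀-greatest {zero} u f l≤u l≤f = l≤u
⋀-greatest {suc k} u f l≤u l≤f = ℕₚ.⊓-glb (l≤f zero) (⋀-greatest u (f ∘ suc) l≤u (l≤f ∘ suc))

module Guess {k n γ : ℕ} (A : Fin k → Fin n → ℕ) (d : Fin n → ℕ) (S : Fin k → Fin γ → Fin (suc n)) where

  heavier? : ∀ j i → Dec (∃ λ s → weight (A j) (S j s) ℕ.< A j i)
  heavier? j i = Finₚ.any? (λ s → weight (A j) (S j s) ℕ.<? A j i)

  cap : Fin n → Fin k → ℕ
  cap i j = if does (heavier? j i) then multiplicity (S j) i else d i

  -- `lo` is a maximum over the rows and not a sum, since the multisets guessed for different rows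
  -- may share units.
  lo hi : Fin n → ℕ
  lo i = ⋁ (λ j → multiplicity (S j) i)
  hi i = ⋀ (d i) (cap i)

  cap-≥ : ∀ {z} i j → z ℕ.≤ d i → ((∃ λ s → weight (A j) (S j s) ℕ.< A j i) → z ℕ.≤ multiplicity (S j) i) →
          z ℕ.≤ cap i j
  cap-≥ i j z≤d z≤S with heavier? j i
  ... | yes heavier = z≤S heavier
  ... | no _ = z≤d

  -- If `i` were heavier than some unit guessed for row `j`, then `hi i` would be at most the
  -- multiplicity of `i` in `S j`, hence at most `lo i`. So a coordinate with room to move is light
  -- in every row.
  not-heavier : ∀ i → lo i ℕ.< hi i → ∀ j s → A j i ℕ.≤ weight (A j) (S j s)
  not-heavier i lo<hi j s with heavier? j i | ⋀≤f (d i) (cap i) j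
  ... | yes _ | hi≤S = contradiction (f≤⋁ (λ j → multiplicity (S j) i) j) (ℕₚ.<⇒≱ (ℕₚ.<-≤-trans lo<hi hi≤S))
  ... | no light | _ = ℕₚ.≮⇒≥ (λ lt → light (s , lt))

-- Restoring feasibility by dropping cheap blocks.

module _ {k n : ℕ} (g : ℕ) (A : Fin k → Fin n → ℕ) (b : Fin k → ℕ) (d : Fin n → ℕ)
         (S : Fin k → Fin (suc g ℕ.* k) → Fin (suc n)) (ε : ℚ) (kg : ι k ℚ.≤ ι (suc g) ℚ.* ε)
         (c : Fin n → ℚ) (0≤c : ∀ i → 0ℚ ℚ.≤ c i)
         where

  open Guess A d S

  Rounded : (Fin n → ℚ) → Set
  Rounded x = ∃ λ z → (∀ i → z i ℕ.≤ d i) × (∀ j → A j ·ℕ z ℕ.≤ b j) ×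
                      (1ℚ ℚ.- ε) ℚ.* (c · x) ℚ.≤ c · (ι ∘ z)

  -- Dropping one block of k guessed units per row pays for the at most k roundings, each of which costs
  -- row j at most the weight of any unit guessed for j.
  drop-blocks : ∀ {z F} → (∀ i → lo i ℕ.≤ z i × z i ℕ.≤ hi i) → count F ℕ.≤ k →
    (∀ i → F i ≡ true → lo i ℕ.< hi i) → (∀ j → A j ·ℕ z ℕ.≤ b j ℕ.+ A j ·ℕ (indicator ∘ F)) →
    ∃ λ z′ → (∀ i → z′ i ℕ.≤ d i) × (∀ j → A j ·ℕ z′ ℕ.≤ b j) ×
             (1ℚ ℚ.- ε) ℚ.* (c · (ι ∘ z)) ℚ.≤ c · (ι ∘ z′)
  drop-blocks {z} {F} box F≤k lo<hi capacity = z′ , z′≤d , capacity′ , value′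
    where
    β : Fin k → Fin (suc g)
    β j = proj₁ (cheap-block {g} {k} c (S j))
    B : ∀ j → Fin k → Fin (suc n)
    B j = block {suc g} {k} (S j) (β j)
    D z′ : Fin n → ℕ
    D i = Σℕ (λ j → multiplicity (B j) i)
    -- Blocks of different rows may overlap, so `D i` can exceed `z i`; truncated subtraction then
    -- removes everything.
    z′ i = z i ℕ.∸ D i
    S≤z : ∀ j i → multiplicity (S j) i ℕ.≤ z i
    S≤z j i = ℕₚ.≤-trans (f≤⋁ (λ j → multiplicity (S j) i) j) (proj₁ (box i))
    z′≤d : ∀ i → z′ i ℕ.≤ d i
    z′≤d i = ℕₚ.≤-trans (ℕₚ.m∸n≤m (z i) (D i)) (ℕₚ.≤-trans (proj₂ (box i)) (⋀≤u (d i) (cap i)))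
    -- For row `j` only its own block is credited, and that block is certainly contained in `z`;
    -- what the other rows remove can only lower the load.
    B+z′≤z : ∀ j i → z′ i ℕ.+ multiplicity (B j) i ℕ.≤ z i
    B+z′≤z j i = ℕₚ.≤-trans
      (ℕₚ.+-monoˡ-≤ (multiplicity (B j) i)
        (ℕₚ.∸-monoʳ-≤ (z i) (ℕΣ.Σ-term-≤ {f = λ j → multiplicity (B j) i} (λ _ → z≤n) j)))
      (ℕₚ.≤-reflexive (ℕₚ.m∸n+n≡m (ℕₚ.≤-trans (block-≤ {suc g} {k} (S j) (β j) i) (S≤z j i))))
    capacity′ : ∀ j → A j ·ℕ z′ ℕ.≤ b j
    capacity′ j = ℕₚ.+-cancelʳ-≤ (A j ·ℕ multiplicity (B j)) (A j ·ℕ z′) (b j) (begin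
      A j ·ℕ z′ ℕ.+ A j ·ℕ multiplicity (B j)                    ≡⟨ ℕΣ.Σ-distrib-+ (λ i → A j i ℕ.* z′ i) _ ⟨
      Σℕ (λ i → A j i ℕ.* z′ i ℕ.+ A j i ℕ.* multiplicity (B j) i)
        ≡⟨ ℕΣ.Σ-cong (λ i → ℕₚ.*-distribˡ-+ (A j i) (z′ i) (multiplicity (B j) i)) ⟨
      A j ·ℕ (λ i → z′ i ℕ.+ multiplicity (B j) i)               ≤⟨ ℕΣ.Σ-mono (λ i → ℕₚ.*-monoʳ-≤ (A j i) (B+z′≤z j i)) ⟩
      A j ·ℕ z                                                   ≤⟨ capacity j ⟩
      b j ℕ.+ A j ·ℕ (indicator ∘ F)                             ≤⟨ ℕₚ.+-monoʳ-≤ (b j)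
        (·ℕ-indicator-≤ (A j) F (λ t → weight (A j) (B j t)) F≤k
          (λ i Fi t → not-heavier i (lo<hi i Fi) j (combine (β j) t))) ⟩
      b j ℕ.+ Σℕ (λ t → weight (A j) (B j t))                    ≡⟨ cong (b j ℕ.+_) (·ℕ-multiplicity (A j) (B j)) ⟨
      b j ℕ.+ A j ·ℕ multiplicity (B j)                          ∎)
      where open ℕₚ.≤-Reasoning
    total loss : ℚ
    total = c · (ι ∘ z)
    loss = c · (ι ∘ D)
    loss-split : loss ≡ Σℚ (λ j → c · (ι ∘ multiplicity (B j)))
    loss-split = trans (ℚΣ.Σ-cong (λ i → cong (c i ℚ.*_) (ι-Σ (λ j → multiplicity (B j) i))))
                       (·-Σ c (λ j → ι ∘ multiplicity (B j)))
    0≤total : 0ℚ ℚ.≤ total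
    0≤total = ·-nonneg 0≤c (λ i → 0≤ι (z i))
    -- Multiplied by `suc g`, each of the `k` blocks costs at most `c · S j`, hence at most `total`;
    -- then `kg` bounds `k` by `suc g` times `ε`.
    g*loss : ι (suc g) ℚ.* loss ℚ.≤ ι (suc g) ℚ.* (ε ℚ.* total)
    g*loss = begin
      ι (suc g) ℚ.* loss                                             ≡⟨ cong (ι (suc g) ℚ.*_) loss-split ⟩
      ι (suc g) ℚ.* Σℚ (λ j → c · (ι ∘ multiplicity (B j)))
        ≡⟨ ℚΣ.Σ-distribˡ-* (ι (suc g)) (λ j → c · (ι ∘ multiplicity (B j))) ⟨
      Σℚ (λ j → ι (suc g) ℚ.* (c · (ι ∘ multiplicity (B j))))
        ≤⟨ ℚΣ.Σ-mono (λ j → ℚₚ.≤-trans (proj₂ (cheap-block {g} {k} c (S j)))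
                                        (·-mono 0≤c (λ i → ι-mono-≤ (S≤z j i)))) ⟩
      Σℚ {k} (λ _ → total)                                           ≡⟨ ℚΣ.Σ-const {k} total ⟩
      Σℚ {k} (λ _ → 1ℚ) ℚ.* total                                    ≡⟨ cong (ℚ._* total) (Σℚ-1 k) ⟩
      ι k ℚ.* total                                                  ≤⟨ *-mono-≤ʳ 0≤total kg ⟩
      ι (suc g) ℚ.* ε ℚ.* total                                      ≡⟨ ℚₚ.*-assoc (ι (suc g)) ε total ⟩
      ι (suc g) ℚ.* (ε ℚ.* total)                                    ∎
      where open ℚₚ.≤-Reasoning
    loss≤ε*total : loss ℚ.≤ ε ℚ.* total
    loss≤ε*total = ℚₚ.*-cancelˡ-≤-pos (ι (suc g)) {{ℚ.positive 0<ι-suc}} g*loss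
      where
      0<ι-suc : 0ℚ ℚ.< ι (suc g)
      0<ι-suc = ℚₚ.<-≤-trans (ℚₚ.positive⁻¹ 1ℚ) (subst (ℚ._≤ ι (suc g)) ι-1 (ι-mono-≤ {1} {suc g} (s≤s z≤n)))
    total≤ : total ℚ.≤ c · (ι ∘ z′) ℚ.+ loss
    total≤ = subst (total ℚ.≤_) (·-distrib-+ c (ι ∘ z′) (ι ∘ D)) (·-mono 0≤c λ i →
      subst (ι (z i) ℚ.≤_) (ι-homo-+ (z′ i) (D i))
        (ι-mono-≤ (subst (z i ℕ.≤_) (ℕₚ.+-comm (D i) (z′ i)) (ℕₚ.m≤n+m∸n (z i) (D i)))))
    value′ : (1ℚ ℚ.- ε) ℚ.* total ℚ.≤ c · (ι ∘ z′)
    value′ = begin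
      (1ℚ ℚ.- ε) ℚ.* total                              ≡⟨ solve 2 (λ e t → (con 1ℚ :- e) :* t := t :- e :* t) refl ε total ⟩
      total ℚ.- ε ℚ.* total                             ≤⟨ ℚₚ.+-mono-≤ total≤ (ℚₚ.neg-antimono-≤ loss≤ε*total) ⟩
      c · (ι ∘ z′) ℚ.+ loss ℚ.- loss                    ≡⟨ solve 2 (λ v l → v :+ l :- l := v) refl (c · (ι ∘ z′)) loss ⟩
      c · (ι ∘ z′)                                      ∎
      where
      open ℚₚ.≤-Reasoning
      open +-*-Solver

  round-guess : ∀ {x} → 0ℚ ℚ.≤ 1ℚ ℚ.- ε → (∀ i → ι (lo i) ℚ.≤ x i × x i ℚ.≤ ι (hi i)) →
                (∀ j → (ι ∘ A j) · x ℚ.≤ ι (b j)) → Rounded x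
  round-guess {x} 0≤1-ε box capacity =
    let (z , F , box-z , F≤k , lo<hi , capacity-z , cx≤cz) = integral-rounding A b lo hi c x 0≤c box capacity
        (z′ , z′≤d , capacity-z′ , value-z′) = drop-blocks {z} {F} box-z F≤k lo<hi capacity-z
    in z′ , z′≤d , capacity-z′ , ℚₚ.≤-trans (*-mono-≤ˡ 0≤1-ε cx≤cz) value-z′

  -- A disjunct enters the relaxation homogenised by its weight `l`. For `l > 0` dividing by `l`
  -- gives a point of the original polytope; for `l = 0` the box forces `X ≤ 0`, and the zero vector
  -- serves.
  round-scaled-guess : ∀ {l X} → 0ℚ ℚ.≤ 1ℚ ℚ.- ε → 0ℚ ℚ.≤ l →
    (∀ i → ι (lo i) ℚ.* l ℚ.≤ X i × X i ℚ.≤ ι (hi i) ℚ.* l) → (∀ j → (ι ∘ A j) · X ℚ.≤ ι (b j) ℚ.* l) →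
    ∃ λ z → (∀ i → z i ℕ.≤ d i) × (∀ j → A j ·ℕ z ℕ.≤ b j) × (1ℚ ℚ.- ε) ℚ.* (c · X) ℚ.≤ l ℚ.* (c · (ι ∘ z))
  round-scaled-guess {l} {X} 0≤1-ε 0≤l box capacity with l ℚ.≟ 0ℚ
  ... | yes refl = (λ _ → 0) , (λ _ → z≤n)
                 , (λ j → ℕₚ.≤-trans (ℕₚ.≤-reflexive (trans (ℕΣ.Σ-cong (λ i → ℕₚ.*-zeroʳ (A j i))) (ℕΣ.Σ-zero {n}))) z≤n)
                 , (begin
      (1ℚ ℚ.- ε) ℚ.* (c · X)        ≤⟨ *-mono-≤ˡ 0≤1-ε cX≤0 ⟩
      (1ℚ ℚ.- ε) ℚ.* 0ℚ             ≡⟨ ℚₚ.*-zeroʳ (1ℚ ℚ.- ε) ⟩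
      0ℚ                            ≡⟨ ℚₚ.*-zeroˡ (c · (λ _ → ι 0)) ⟨
      0ℚ ℚ.* (c · (λ _ → ι 0))      ∎)
    where
    open ℚₚ.≤-Reasoning
    cX≤0 : c · X ℚ.≤ 0ℚ
    cX≤0 = begin
      c · X               ≤⟨ ·-mono 0≤c (λ i → ℚₚ.≤-trans (proj₂ (box i)) (ℚₚ.≤-reflexive (ℚₚ.*-zeroʳ (ι (hi i))))) ⟩
      c · (λ _ → 0ℚ)      ≡⟨ ℚΣ.Σ-cong (λ i → ℚₚ.*-zeroʳ (c i)) ⟩
      Σℚ {n} (λ _ → 0ℚ)   ≡⟨ ℚΣ.Σ-zero {n} ⟩
      0ℚ                  ∎
  ... | no l≢0 =
    let (z , z≤d , capacity-z , value-z) = round-guess {λ i → 1/ l ℚ.* X i} 0≤1-ε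
          (λ i → unscale-≥ (proj₁ (box i)) , unscale-≤ (proj₂ (box i)))
          (λ j → subst (ℚ._≤ ι (b j)) (≡.sym (·-scale (ι ∘ A j))) (unscale-≤ (capacity j)))
    in z , z≤d , capacity-z , subst (ℚ._≤ l ℚ.* (c · (ι ∘ z))) rescale (*-mono-≤ˡ 0≤l value-z)
    where
    instance
      _ = ℚ.positive (ℚₚ.≰⇒> (λ l≤0 → l≢0 (ℚₚ.≤-antisym l≤0 0≤l)))
      _ = ℚₚ.pos⇒nonZero l
    open +-*-Solver
    0≤1/l : 0ℚ ℚ.≤ 1/ l
    0≤1/l = ℚₚ.<⇒≤ (ℚₚ.positive⁻¹ (1/ l) {{ℚₚ.1/pos⇒pos l}})
    cancel : ∀ p → 1/ l ℚ.* (p ℚ.* l) ≡ p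
    cancel p = trans (solve 3 (λ i p l → i :* (p :* l) := (i :* l) :* p) refl (1/ l) p l)
      (trans (cong (ℚ._* p) (ℚₚ.*-inverseˡ l)) (ℚₚ.*-identityˡ p))
    unscale-≤ : ∀ {p q} → q ℚ.≤ p ℚ.* l → 1/ l ℚ.* q ℚ.≤ p
    unscale-≤ {p} {q} le = subst (1/ l ℚ.* q ℚ.≤_) (cancel p) (*-mono-≤ˡ 0≤1/l le)
    unscale-≥ : ∀ {p q} → p ℚ.* l ℚ.≤ q → p ℚ.≤ 1/ l ℚ.* q
    unscale-≥ {p} {q} le = subst (ℚ._≤ 1/ l ℚ.* q) (cancel p) (*-mono-≤ˡ 0≤1/l le)
    ·-scale : ∀ a → a · (λ i → 1/ l ℚ.* X i) ≡ 1/ l ℚ.* (a · X)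
    ·-scale a = trans (ℚΣ.Σ-cong (λ i → solve 3 (λ a i x → a :* (i :* x) := i :* (a :* x)) refl (a i) (1/ l) (X i)))
      (ℚΣ.Σ-distribˡ-* (1/ l) (λ i → a i ℚ.* X i))
    rescale : l ℚ.* ((1ℚ ℚ.- ε) ℚ.* (c · (λ i → 1/ l ℚ.* X i))) ≡ (1ℚ ℚ.- ε) ℚ.* (c · X)
    rescale = trans (cong (λ s → l ℚ.* ((1ℚ ℚ.- ε) ℚ.* s)) (·-scale c))
      (trans (solve 4 (λ l e i s → l :* (e :* (i :* s)) := i :* (e :* s :* l)) refl l (1ℚ ℚ.- ε) (1/ l) (c · X))
             (cancel ((1ℚ ℚ.- ε) ℚ.* (c · X))))

-- Affine expressions as rows of a linear program.

-- Reified expressions let the coefficients be computed from a readable row, while the proofs work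
-- with the inequality between its two values.
data Expr (n m : ℕ) : Set where
  x⟨_⟩ : Fin n → Expr n m
  y⟨_⟩ : Fin m → Expr n m
  con  : ℚ → Expr n m
  _⊡_  : ℚ → Expr n m → Expr n m
  ∑    : ∀ {l} → (Fin l → Expr n m) → Expr n m

eval : ∀ {n m} → (Fin n → ℚ) → (Fin m → ℚ) → Expr n m → ℚ
eval x y x⟨ i ⟩   = x i
eval x y y⟨ i ⟩   = y i
eval x y (con q)  = q
eval x y (q ⊡ e)  = q ℚ.* eval x y e
eval x y (∑ e)    = Σℚ (λ l → eval x y (e l))

coefX : ∀ {n m} → Expr n m → Fin n → ℚ
coefX x⟨ p ⟩   i = ℚΣ.δ p i
coefX y⟨ _ ⟩   i = 0ℚ
coefX (con _)  i = 0ℚ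
coefX (q ⊡ e)  i = q ℚ.* coefX e i
coefX (∑ e)    i = Σℚ (λ l → coefX (e l) i)

coefY : ∀ {n m} → Expr n m → Fin m → ℚ
coefY x⟨ _ ⟩   i = 0ℚ
coefY y⟨ p ⟩   i = ℚΣ.δ p i
coefY (con _)  i = 0ℚ
coefY (q ⊡ e)  i = q ℚ.* coefY e i
coefY (∑ e)    i = Σℚ (λ l → coefY (e l) i)

constant : ∀ {n m} → Expr n m → ℚ
constant x⟨ _ ⟩   = 0ℚ
constant y⟨ _ ⟩   = 0ℚ
constant (con q)  = q
constant (q ⊡ e)  = q ℚ.* constant e
constant (∑ e)    = Σℚ (λ l → constant (e l))

0·x≡0 : ∀ {n} (x : Fin n → ℚ) → (λ _ → 0ℚ) · x ≡ 0ℚ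
0·x≡0 {n} x = trans (ℚΣ.Σ-cong (λ i → ℚₚ.*-zeroˡ (x i))) (ℚΣ.Σ-zero {n})

scale-· : ∀ {n} q (a x : Fin n → ℚ) → (λ i → q ℚ.* a i) · x ≡ q ℚ.* (a · x)
scale-· q a x = trans (ℚΣ.Σ-cong (λ i → ℚₚ.*-assoc q (a i) (x i))) (ℚΣ.Σ-distribˡ-* q (λ i → a i ℚ.* x i))

Σ-· : ∀ {l n} (a : Fin l → Fin n → ℚ) x → (λ i → Σℚ (λ l → a l i)) · x ≡ Σℚ (λ l → a l · x)
Σ-· a x = trans (ℚΣ.Σ-cong (λ i → ≡.sym (ℚΣ.Σ-distribʳ-* (x i) (λ l → a l i))))
  (ℚΣ.Σ-swap (λ i l → a l i ℚ.* x i))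

eval-coefficients : ∀ {n m} (x : Fin n → ℚ) (y : Fin m → ℚ) e →
                    coefX e · x ℚ.+ coefY e · y ℚ.+ constant e ≡ eval x y e
eval-coefficients x y x⟨ p ⟩ = trans (cong₂ (λ s t → s ℚ.+ t ℚ.+ 0ℚ) (ℚΣ.Σ-δ p x) (0·x≡0 y))
  (solve 1 (λ s → s :+ con 0ℚ :+ con 0ℚ := s) refl (x p))
  where open +-*-Solver
eval-coefficients x y y⟨ p ⟩ = trans (cong₂ (λ s t → s ℚ.+ t ℚ.+ 0ℚ) (0·x≡0 x) (ℚΣ.Σ-δ p y))
  (solve 1 (λ s → con 0ℚ :+ s :+ con 0ℚ := s) refl (y p))
  where open +-*-Solver
eval-coefficients x y (con q) = trans (cong₂ (λ s t → s ℚ.+ t ℚ.+ q) (0·x≡0 x) (0·x≡0 y))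
  (solve 1 (λ s → con 0ℚ :+ con 0ℚ :+ s := s) refl q)
  where open +-*-Solver
eval-coefficients x y (q ⊡ e) = begin
  coefX (q ⊡ e) · x ℚ.+ coefY (q ⊡ e) · y ℚ.+ q ℚ.* constant e
    ≡⟨ cong₂ (λ s t → s ℚ.+ t ℚ.+ q ℚ.* constant e) (scale-· q (coefX e) x) (scale-· q (coefY e) y) ⟩
  q ℚ.* (coefX e · x) ℚ.+ q ℚ.* (coefY e · y) ℚ.+ q ℚ.* constant e
    ≡⟨ solve 4 (λ q s t u → q :* s :+ q :* t :+ q :* u := q :* (s :+ t :+ u)) refl q (coefX e · x) (coefY e · y) (constant e) ⟩
  q ℚ.* (coefX e · x ℚ.+ coefY e · y ℚ.+ constant e)  ≡⟨ cong (q ℚ.*_) (eval-coefficients x y e) ⟩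
  q ℚ.* eval x y e                                    ∎
  where
  open +-*-Solver
  open ≡-Reasoning
eval-coefficients x y (∑ e) = begin
  coefX (∑ e) · x ℚ.+ coefY (∑ e) · y ℚ.+ constant (∑ e)
    ≡⟨ cong₂ (λ s t → s ℚ.+ t ℚ.+ constant (∑ e)) (Σ-· (coefX ∘ e) x) (Σ-· (coefY ∘ e) y) ⟩
  Σℚ (λ l → coefX (e l) · x) ℚ.+ Σℚ (λ l → coefY (e l) · y) ℚ.+ Σℚ (λ l → constant (e l))
    ≡⟨ cong (ℚ._+ Σℚ (λ l → constant (e l))) (ℚΣ.Σ-distrib-+ (λ l → coefX (e l) · x) (λ l → coefY (e l) · y)) ⟨
  Σℚ (λ l → coefX (e l) · x ℚ.+ coefY (e l) · y) ℚ.+ Σℚ (λ l → constant (e l))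
    ≡⟨ ℚΣ.Σ-distrib-+ (λ l → coefX (e l) · x ℚ.+ coefY (e l) · y) (λ l → constant (e l)) ⟨
  Σℚ (λ l → coefX (e l) · x ℚ.+ coefY (e l) · y ℚ.+ constant (e l))
    ≡⟨ ℚΣ.Σ-cong (λ l → eval-coefficients x y (e l)) ⟩
  Σℚ (λ l → eval x y (e l))                                          ∎
  where open ≡-Reasoning

infix 4 _⊑_

record Row (n m : ℕ) : Set where
  constructor _⊑_
  field
    lhs rhs : Expr n m

open Row

Holds : ∀ {n m} → (Fin n → ℚ) → (Fin m → ℚ) → Row n m → Set
Holds x y r = eval x y (lhs r) ℚ.≤ eval x y (rhs r)

rowX : ∀ {n m} → Row n m → Fin n → ℚ
rowX r i = coefX (lhs r) i ℚ.- coefX (rhs r) i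

rowY : ∀ {n m} → Row n m → Fin m → ℚ
rowY r i = coefY (lhs r) i ℚ.- coefY (rhs r) i

rowBound : ∀ {n m} → Row n m → ℚ
rowBound r = constant (rhs r) ℚ.- constant (lhs r)

difference-· : ∀ {n} (a b x : Fin n → ℚ) → (λ i → a i ℚ.- b i) · x ≡ a · x ℚ.- b · x
difference-· a b x = begin
  (λ i → a i ℚ.- b i) · x
    ≡⟨ ℚΣ.Σ-cong (λ i → solve 3 (λ a b x → (a :- b) :* x := con 1ℚ :* (a :* x) :+ (:- con 1ℚ) :* (b :* x)) refl (a i) (b i) (x i)) ⟩
  Σℚ (λ i → 1ℚ ℚ.* (a i ℚ.* x i) ℚ.+ (ℚ.- 1ℚ) ℚ.* (b i ℚ.* x i))
    ≡⟨ Σ-linear 1ℚ (ℚ.- 1ℚ) (λ i → a i ℚ.* x i) (λ i → b i ℚ.* x i) ⟩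
  1ℚ ℚ.* (a · x) ℚ.+ (ℚ.- 1ℚ) ℚ.* (b · x)
    ≡⟨ solve 2 (λ s t → con 1ℚ :* s :+ (:- con 1ℚ) :* t := s :- t) refl (a · x) (b · x) ⟩
  a · x ℚ.- b · x  ∎
  where
  open ≡-Reasoning
  open +-*-Solver

row-identity : ∀ {n m} (x : Fin n → ℚ) (y : Fin m → ℚ) r →
  (rowX r · x ℚ.+ rowY r · y) ℚ.- rowBound r ≡ eval x y (lhs r) ℚ.- eval x y (rhs r)
row-identity x y r@(l ⊑ u) = begin
  (rowX r · x ℚ.+ rowY r · y) ℚ.- rowBound r
    ≡⟨ cong₂ (λ s t → (s ℚ.+ t) ℚ.- rowBound r) (difference-· (coefX l) (coefX u) x) (difference-· (coefY l) (coefY u) y) ⟩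
  ((coefX l · x ℚ.- coefX u · x) ℚ.+ (coefY l · y ℚ.- coefY u · y)) ℚ.- (constant u ℚ.- constant l)
    ≡⟨ solve 6 (λ a b c d e f → ((a :- b) :+ (c :- d)) :- (e :- f) := (a :+ c :+ f) :- (b :+ d :+ e)) refl
         (coefX l · x) (coefX u · x) (coefY l · y) (coefY u · y) (constant u) (constant l) ⟩
  (coefX l · x ℚ.+ coefY l · y ℚ.+ constant l) ℚ.- (coefX u · x ℚ.+ coefY u · y ℚ.+ constant u)
    ≡⟨ cong₂ ℚ._-_ (eval-coefficients x y l) (eval-coefficients x y u) ⟩
  eval x y l ℚ.- eval x y u  ∎
  where
  open ≡-Reasoning
  open +-*-Solver

≤-by-difference : ∀ {p q r s} → p ℚ.- q ≡ r ℚ.- s → p ℚ.≤ q → r ℚ.≤ s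
≤-by-difference {p} {q} {r} {s} eq p≤q = begin
  r                   ≡⟨ solve 2 (λ r s → r := (r :- s) :+ s) refl r s ⟩
  (r ℚ.- s) ℚ.+ s     ≡⟨ cong (ℚ._+ s) eq ⟨
  (p ℚ.- q) ℚ.+ s     ≤⟨ ℚₚ.+-monoˡ-≤ s (ℚₚ.+-monoˡ-≤ (ℚ.- q) p≤q) ⟩
  (q ℚ.- q) ℚ.+ s     ≡⟨ solve 2 (λ q s → (q :- q) :+ s := s) refl q s ⟩
  s                   ∎
  where
  open ℚₚ.≤-Reasoning
  open +-*-Solver

linearProgram : ∀ {n} m → List (Row n m) → ExtLP n
linearProgram m rows = record
  { extraVars = m
  ; constraints = List.length rows
  ; Gx = λ j → rowX (List.lookup rows j)
  ; Gy = λ j → rowY (List.lookup rows j)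
  ; h = λ j → rowBound (List.lookup rows j)
  }

feasible⇒holds : ∀ {n m} (rows : List (Row n m)) {x y} →
                 LPFeasible (linearProgram m rows) x y → All (Holds x y) rows
feasible⇒holds [] feasible = []
feasible⇒holds (r ∷ rows) {x} {y} feasible =
  ≤-by-difference (row-identity x y r) (feasible zero) ∷ feasible⇒holds rows (feasible ∘ suc)

holds⇒feasible : ∀ {n m} {rows : List (Row n m)} {x y} →
                 All (Holds x y) rows → LPFeasible (linearProgram m rows) x y
holds⇒feasible {x = x} {y} (_∷_ {x = r} h hs) zero = ≤-by-difference (≡.sym (row-identity x y r)) h
holds⇒feasible (h ∷ hs) (suc j) = holds⇒feasible hs j

-- This is where the number of blocks comes from. The successor makes it positive, so that a
-- cheapest block exists.
archimedean : ∀ {ε} q → 0ℚ ℚ.< ε → ∃ λ g → q ℚ.≤ ι (suc g) ℚ.* ε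
archimedean {ε} q 0<ε = let (g , q/ε≤g) = natural-upper-bound (q ℚ.* 1/ ε) in g , (begin
  q                         ≡⟨ ℚₚ.*-identityʳ q ⟨
  q ℚ.* 1ℚ                  ≡⟨ cong (q ℚ.*_) (ℚₚ.*-inverseˡ ε) ⟨
  q ℚ.* (1/ ε ℚ.* ε)        ≡⟨ ℚₚ.*-assoc q (1/ ε) ε ⟨
  q ℚ.* 1/ ε ℚ.* ε          ≤⟨ *-mono-≤ʳ (ℚₚ.<⇒≤ 0<ε) (ℚₚ.≤-trans q/ε≤g (ι-mono-≤ (ℕₚ.n≤1+n g))) ⟩
  ι (suc g) ℚ.* ε           ∎)
  where
  open ℚₚ.≤-Reasoning
  instance
    _ = ℚ.positive 0<ε
    _ = ℚₚ.pos⇒nonZero ε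

length-concat-tabulate : ∀ {A : Set} {m} (f : Fin m → List A) {s} → (∀ i → List.length (f i) ≡ s) →
                         List.length (List.concat (List.tabulate f)) ≡ m ℕ.* s
length-concat-tabulate {m = zero} f eq = refl
length-concat-tabulate {m = suc m} f eq = trans (Listₚ.length-++ (f zero))
  (cong₂ ℕ._+_ (eq zero) (length-concat-tabulate (f ∘ suc) (eq ∘ suc)))

+-Σ : ∀ {n} (f : Fin n → ℕ) (h : Fin n → ℤ) → (∀ i → h i ≡ + f i) → Σℤ h ≡ + Σℕ f
+-Σ {zero} f h eq = refl
+-Σ {suc n} f h eq = cong₂ ℤ._+_ (eq zero) (+-Σ (f ∘ suc) (h ∘ suc) (eq ∘ suc))

-- The disjunctive relaxation and its rows.

module Relaxation {k : ℕ} (I : KnapsackData k) (g : ℕ) where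

  open KnapsackData I

  -- The case `d i = nothing` splits in two: a `packed` item loads some row, whose capacity bounds
  -- it implicitly, whereas a `free` item loads none and is truly unbounded.
  data Item (i : Fin n) : Set where
    limited : ∀ u → d i ≡ just u → Item i
    packed  : d i ≡ nothing → ∀ j → A j i ≢ 0 → Item i
    free    : d i ≡ nothing → (∀ j → A j i ≡ 0) → Item i

  item : ∀ i → Item i
  item i with d i in eq | Finₚ.any? (λ j → ¬? (A j i ℕ.≟ 0))
  ... | just u  | _             = limited u eq
  ... | nothing | yes (j , A≢0) = packed eq j A≢0
  ... | nothing | no none       = free eq (λ j → decidable-stable (A j i ℕ.≟ 0) (λ A≢0 → none (j , A≢0)))

  -- Free items are left out of the disjunction (bound 0), so that every disjunct is bounded and needs no recession cone.
  bound : ∀ {i} → Item i → ℕ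
  bound (limited u _)  = u
  bound (packed _ _ _) = Σℕ b
  bound (free _ _)     = 0

  limit : Fin n → ℕ
  limit i = bound (item i)

  Units : Set
  Units = Fin k → Fin (suc g ℕ.* k) → Fin (suc n)

  -- A guess is `k` functions from the units to `suc n` choices, so the exponent depends on `k` and
  -- `g` alone. Each guess owns `suc n` variables: its weight and its scaled copy of the point.
  guesses variables : ℕ
  guesses = (suc n ^ (suc g ℕ.* k)) ^ k
  variables = guesses ℕ.* suc n

  decode : Fin guesses → Units
  decode σ j = finToFun (finToFun σ j)

  encode : Units → Fin guesses
  encode S = funToFin (λ j → funToFin (S j))

  decode-encode : ∀ S j s → decode (encode S) j s ≡ S j s
  decode-encode S j s = trans (cong (λ q → finToFun q s) (Finₚ.finToFun-funToFin (λ j → funToFin (S j)) j))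
    (Finₚ.finToFun-funToFin (S j) s)

  module G (σ : Fin guesses) = Guess A limit (decode σ)

  λᵛ : Fin guesses → Fin variables
  λᵛ σ = combine σ zero

  Xᵛ : Fin guesses → Fin n → Fin variables
  Xᵛ σ i = combine σ (suc i)

  -- An inequality fits a packing problem: lowering `x` toward 0 keeps it feasible. A free item has
  -- no share in the disjunction and receives the vacuous row `0 ≤ 0`, so that every item has
  -- exactly one row.
  link : ∀ {i} → Item i → Row n variables
  link {i} (limited _ _)  = x⟨ i ⟩ ⊑ ∑ (λ σ → y⟨ Xᵛ σ i ⟩)
  link {i} (packed _ _ _) = x⟨ i ⟩ ⊑ ∑ (λ σ → y⟨ Xᵛ σ i ⟩)
  link     (free _ _)     = con 0ℚ ⊑ con 0ℚ

  lowerRow upperRow : Fin guesses → Fin n → Row n variables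
  lowerRow σ i = ι (G.lo σ i) ⊡ y⟨ λᵛ σ ⟩ ⊑ y⟨ Xᵛ σ i ⟩
  upperRow σ i = y⟨ Xᵛ σ i ⟩ ⊑ ι (G.hi σ i) ⊡ y⟨ λᵛ σ ⟩

  capacityRow : Fin guesses → Fin k → Row n variables
  capacityRow σ j = ∑ (λ i → ι (A j i) ⊡ y⟨ Xᵛ σ i ⟩) ⊑ ι (b j) ⊡ y⟨ λᵛ σ ⟩

  guessRows : Fin guesses → List (Row n variables)
  guessRows σ = (con 0ℚ ⊑ y⟨ λᵛ σ ⟩)
              ∷ List.tabulate (lowerRow σ) ++ List.tabulate (upperRow σ) ++ List.tabulate (capacityRow σ)

  nonnegRow linkRow : Fin n → Row n variables
  nonnegRow i = con 0ℚ ⊑ x⟨ i ⟩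
  linkRow i = link (item i)

  -- The weights may sum to less than 1; the missing weight belongs to the zero vector, which is
  -- feasible.
  rows : List (Row n variables)
  rows = (∑ (λ σ → y⟨ λᵛ σ ⟩) ⊑ con 1ℚ)
       ∷ List.tabulate nonnegRow ++ List.tabulate linkRow
      ++ List.concat (List.tabulate guessRows)

  relaxation : ExtLP n
  relaxation = linearProgram variables rows

  module _ (x : Fin n → ℚ) (y : Fin variables → ℚ) where

    record SatGuess (σ : Fin guesses) : Set where
      field
        0≤λ        : 0ℚ ℚ.≤ y (λᵛ σ)
        lower      : ∀ i → ι (G.lo σ i) ℚ.* y (λᵛ σ) ℚ.≤ y (Xᵛ σ i)
        upper      : ∀ i → y (Xᵛ σ i) ℚ.≤ ι (G.hi σ i) ℚ.* y (λᵛ σ)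
        capacity   : ∀ j → (ι ∘ A j) · (y ∘ Xᵛ σ) ℚ.≤ ι (b j) ℚ.* y (λᵛ σ)

    record Sat : Set where
      field
        weights≤1  : Σℚ (λ σ → y (λᵛ σ)) ℚ.≤ 1ℚ
        0≤x        : ∀ i → 0ℚ ℚ.≤ x i
        linked     : ∀ i → Holds x y (link (item i))
        guessed    : ∀ σ → SatGuess σ

    holds⇒satGuess : ∀ σ → All (Holds x y) (guessRows σ) → SatGuess σ
    holds⇒satGuess σ holds = record
      { 0≤λ = All.head holds
      ; lower = Allₚ.tabulate⁻ (Allₚ.++⁻ˡ (List.tabulate (lowerRow σ)) (All.tail holds))
      ; upper = Allₚ.tabulate⁻ (Allₚ.++⁻ˡ (List.tabulate (upperRow σ)) rest)
      ; capacity = Allₚ.tabulate⁻ (Allₚ.++⁻ʳ (List.tabulate (upperRow σ)) rest)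
      }
      where
      rest : All (Holds x y) (List.tabulate (upperRow σ) ++ List.tabulate (capacityRow σ))
      rest = Allₚ.++⁻ʳ (List.tabulate (lowerRow σ)) (All.tail holds)

    holds⇒sat : All (Holds x y) rows → Sat
    holds⇒sat holds = record
      { weights≤1 = All.head holds
      ; 0≤x = Allₚ.tabulate⁻ (Allₚ.++⁻ˡ (List.tabulate nonnegRow) (All.tail holds))
      ; linked = Allₚ.tabulate⁻ (Allₚ.++⁻ˡ (List.tabulate linkRow) rest)
      ; guessed = λ σ → holds⇒satGuess σ (Allₚ.tabulate⁻ (Allₚ.concat⁻ (Allₚ.++⁻ʳ (List.tabulate linkRow) rest)) σ)
      }
      where
      rest : All (Holds x y) (List.tabulate linkRow ++ List.concat (List.tabulate guessRows))
      rest = Allₚ.++⁻ʳ (List.tabulate nonnegRow) (All.tail holds)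

    feasible⇒sat : LPFeasible relaxation x y → Sat
    feasible⇒sat feasible = holds⇒sat (feasible⇒holds rows feasible)

    sat⇒feasible : Sat → LPFeasible relaxation x y
    sat⇒feasible sat = holds⇒feasible
      (weights≤1 ∷ Allₚ.++⁺ (Allₚ.tabulate⁺ 0≤x) (Allₚ.++⁺ (Allₚ.tabulate⁺ linked)
        (Allₚ.concat⁺ (Allₚ.tabulate⁺ (λ σ → let open SatGuess (guessed σ) in
          0≤λ ∷ Allₚ.++⁺ (Allₚ.tabulate⁺ lower) (Allₚ.++⁺ (Allₚ.tabulate⁺ upper) (Allₚ.tabulate⁺ capacity)))))))
      where open Sat sat

    -- Integral points of the relaxation are feasible for the knapsack.

    module Sound (sat : Sat) where

      open Sat sat

      X : Fin n → ℚ
      X i = Σℚ (λ σ → y (Xᵛ σ i))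

      -- The convexity argument: a bound that holds in every disjunct, scaled by its weight,
      -- survives summation because the total weight is at most 1.
      scaled-sum-≤ : ∀ {f} q → 0ℚ ℚ.≤ q → (∀ σ → f σ ℚ.≤ q ℚ.* y (λᵛ σ)) → Σℚ f ℚ.≤ q
      scaled-sum-≤ {f} q 0≤q le = begin
        Σℚ f                               ≤⟨ ℚΣ.Σ-mono le ⟩
        Σℚ (λ σ → q ℚ.* y (λᵛ σ))          ≡⟨ ℚΣ.Σ-distribˡ-* q (λ σ → y (λᵛ σ)) ⟩
        q ℚ.* Σℚ (λ σ → y (λᵛ σ))          ≤⟨ *-mono-≤ˡ 0≤q weights≤1 ⟩
        q ℚ.* 1ℚ                           ≡⟨ ℚₚ.*-identityʳ q ⟩
        q                                  ∎
        where open ℚₚ.≤-Reasoning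

      0≤X : ∀ i → 0ℚ ℚ.≤ X i
      0≤X i = ℚΣ.Σ-nonneg (λ σ → let open SatGuess (guessed σ) in
        ℚₚ.≤-trans (*-nonneg (0≤ι (G.lo σ i)) 0≤λ) (lower i))

      X≤limit : ∀ i → X i ℚ.≤ ι (limit i)
      X≤limit i = scaled-sum-≤ (ι (limit i)) (0≤ι (limit i)) (λ σ → let open SatGuess (guessed σ) in
        ℚₚ.≤-trans (upper i) (*-mono-≤ʳ 0≤λ (ι-mono-≤ (⋀≤u (limit i) (G.cap σ i)))))

      x≤X⊎free : ∀ i → x i ℚ.≤ X i ⊎ (∀ j → A j i ≡ 0)
      x≤X⊎free i = helper (item i) (linked i)
        where
        helper : (t : Item i) → Holds x y (link t) → x i ℚ.≤ X i ⊎ (∀ j → A j i ≡ 0)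
        helper (limited _ _) h = inj₁ h
        helper (packed _ _ _) h = inj₁ h
        helper (free _ A≡0) _ = inj₂ A≡0

      x≤d : ∀ i {u} → d i ≡ just u → x i ℚ.≤ ι u
      x≤d i {u} d≡u = helper (item i) (linked i) (X≤limit i)
        where
        helper : (t : Item i) → Holds x y (link t) → X i ℚ.≤ ι (bound t) → x i ℚ.≤ ι u
        helper (limited u′ d≡u′) x≤X X≤u′ with refl ← trans (≡.sym d≡u) d≡u′ = ℚₚ.≤-trans x≤X X≤u′
        helper (packed d≡∞ _ _) _ _ = case trans (≡.sym d≡u) d≡∞ of λ ()
        helper (free d≡∞ _) _ _ = case trans (≡.sym d≡u) d≡∞ of λ ()

      -- Only on free items may `x` exceed `X`, and these have weight 0 in every row, so the
      -- comparison with `X` holds term by term.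
      Ax≤b : ∀ j → (ι ∘ A j) · x ℚ.≤ ι (b j)
      Ax≤b j = begin
        (ι ∘ A j) · x                                ≤⟨ ℚΣ.Σ-mono termwise ⟩
        (ι ∘ A j) · X                                ≡⟨ ·-Σ (ι ∘ A j) (λ σ → y ∘ Xᵛ σ) ⟩
        Σℚ (λ σ → (ι ∘ A j) · (y ∘ Xᵛ σ))            ≤⟨ scaled-sum-≤ (ι (b j)) (0≤ι (b j)) (λ σ → SatGuess.capacity (guessed σ) j) ⟩
        ι (b j)                                      ∎
        where
        open ℚₚ.≤-Reasoning
        0*q : ∀ {a} q → a ≡ 0 → ι a ℚ.* q ≡ 0ℚ
        0*q q refl = trans (cong (ℚ._* q) ι-0) (ℚₚ.*-zeroˡ q)
        termwise : ∀ i → ι (A j i) ℚ.* x i ℚ.≤ ι (A j i) ℚ.* X i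
        termwise i = case x≤X⊎free i of λ
          { (inj₁ x≤X) → *-mono-≤ˡ (0≤ι (A j i)) x≤X
          ; (inj₂ A≡0) → ℚₚ.≤-reflexive (trans (0*q (x i) (A≡0 j)) (≡.sym (0*q (X i) (A≡0 j))))
          }

  sound : ∀ z y → Sat (λ i → toℚ (z i)) y → KnapsackFeasible I z
  sound z y sat = (λ i → toℚ-cancel-≤ {+ 0} {z i} (Sat.0≤x sat i) , below i (d i) refl) , capacity
    where
    open Sound (λ i → toℚ (z i)) y sat
    below : ∀ i m → d i ≡ m → BelowBound (z i) m
    below i nothing _ = tt
    below i (just u) d≡u = toℚ-cancel-≤ {z i} {+ u} (subst (toℚ (z i) ℚ.≤_) (≡.sym (toℚ≡ι u)) (x≤d i d≡u))
    capacity : ∀ j → Σℤ (λ i → + A j i ℤ.* z i) ℤ.≤ + b j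
    capacity j = toℚ-cancel-≤ {Σℤ (λ i → + A j i ℤ.* z i)} {+ b j} (begin
      toℚ (Σℤ (λ i → + A j i ℤ.* z i))      ≡⟨ toℚ-Σ (λ i → + A j i ℤ.* z i) ⟩
      Σℚ (λ i → toℚ (+ A j i ℤ.* z i))
        ≡⟨ ℚΣ.Σ-cong (λ i → trans (toℚ-homo-* (+ A j i) (z i)) (cong (ℚ._* toℚ (z i)) (toℚ≡ι (A j i)))) ⟩
      (ι ∘ A j) · (λ i → toℚ (z i))         ≤⟨ Ax≤b j ⟩
      ι (b j)                               ≡⟨ toℚ≡ι (b j) ⟨
      toℚ (+ b j)                           ∎)
      where open ℚₚ.≤-Reasoning

  -- Every feasible integral point lifts to the relaxation.

  taken : ∀ {i} → Item i → ℤ → ℕ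
  taken (limited _ _) z  = ℤ.∣ z ∣
  taken (packed _ _ _) z = ℤ.∣ z ∣
  taken (free _ _) z     = 0

  module Complete (z : Fin n → ℤ) (feasible : KnapsackFeasible I z) where

    -- The part of `z` that the disjunction sees: free items are set to 0, in accordance with their
    -- bound.
    m : Fin n → ℕ
    m i = taken (item i) (z i)

    +∣z∣≡z : ∀ i → + ℤ.∣ z i ∣ ≡ z i
    +∣z∣≡z i = ℤₚ.0≤i⇒+∣i∣≡i (proj₁ (proj₁ feasible i))

    Am≤b : ∀ j → A j ·ℕ m ℕ.≤ b j
    Am≤b j = ℤₚ.drop‿+≤+ (subst (ℤ._≤ + b j) (+-Σ (λ i → A j i ℕ.* m i) _ (λ i → termwise i (item i))) (proj₂ feasible j))
      where
      termwise : ∀ i (t : Item i) → + A j i ℤ.* z i ≡ + (A j i ℕ.* taken t (z i))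
      nonfree : ∀ i → + A j i ℤ.* z i ≡ + (A j i ℕ.* ℤ.∣ z i ∣)
      nonfree i = ≡.sym (trans (ℤₚ.pos-* (A j i) ℤ.∣ z i ∣) (cong (+ A j i ℤ.*_) (+∣z∣≡z i)))
      termwise i (limited _ _) = nonfree i
      termwise i (packed _ _ _) = nonfree i
      termwise i (free _ A≡0) = trans (cong (λ a → + a ℤ.* z i) (A≡0 j))
        (cong (λ a → + (a ℕ.* 0)) (≡.sym (A≡0 j)))

    m≤limit : ∀ i → m i ℕ.≤ limit i
    m≤limit i = helper (item i) refl
      where
      helper : ∀ t → m i ≡ taken t (z i) → m i ℕ.≤ bound t
      helper (limited u d≡u) eq = ℤₚ.drop‿+≤+ (subst (ℤ._≤ + u) (≡.sym (trans (cong +_ eq) (+∣z∣≡z i)))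
        (subst (BelowBound (z i)) d≡u (proj₂ (proj₁ feasible i))))
      -- As `A j i` is at least 1, `m i` is at most its own load on row `j`, hence at most `b j`.
      helper (packed _ j A≢0) _ = begin
        m i                    ≤⟨ ℕₚ.m≤n*m (m i) (A j i) {{ℕ.≢-nonZero A≢0}} ⟩
        A j i ℕ.* m i          ≤⟨ ℕΣ.Σ-term-≤ {f = λ i → A j i ℕ.* m i} (λ _ → z≤n) i ⟩
        A j ·ℕ m               ≤⟨ Am≤b j ⟩
        b j                    ≤⟨ ℕΣ.Σ-term-≤ {f = b} (λ _ → z≤n) j ⟩
        Σℕ b                   ∎
        where open ℕₚ.≤-Reasoning
      helper (free _ _) eq = ℕₚ.≤-reflexive eq

    S : Units
    S j = proj₁ (heaviest (suc g ℕ.* k) (A j) m)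

    σ₀ : Fin guesses
    σ₀ = encode S

    -- Decoding returns `S` only pointwise, so facts about `S` are carried over through the
    -- individual units.
    multiplicity-decode : ∀ j i → multiplicity (decode σ₀ j) i ≡ multiplicity (S j) i
    multiplicity-decode j i = ℕΣ.Σ-cong (λ s → cong (λ q → choice q i) (decode-encode S j s))

    lo≤m : ∀ i → G.lo σ₀ i ℕ.≤ m i
    lo≤m i = ⋁-least (λ j → multiplicity (decode σ₀ j) i) (λ j →
      subst (ℕ._≤ m i) (≡.sym (multiplicity-decode j i)) (proj₁ (proj₂ (heaviest (suc g ℕ.* k) (A j) m)) i))

    m≤hi : ∀ i → m i ℕ.≤ G.hi σ₀ i
    m≤hi i = ⋀-greatest (limit i) (G.cap σ₀ i) (m≤limit i) (λ j → G.cap-≥ σ₀ i j (m≤limit i) (λ (s , lighter) →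
      subst (m i ℕ.≤_) (≡.sym (multiplicity-decode j i))
        (proj₂ (proj₂ (heaviest (suc g ℕ.* k) (A j) m)) i
          (s , subst (λ q → weight (A j) q ℕ.< A j i) (decode-encode S j s) lighter))))

    v : Fin (suc n) → ℚ
    v zero = 1ℚ
    v (suc i) = ι (m i)

    -- All weight goes to the guess `σ₀` read off from `z`, every other guess receives zeros. Within
    -- a guess, slot 0 is the weight and slot `suc i` the copy of coordinate `i`.
    y : Fin variables → ℚ
    y q = ℚΣ.δ σ₀ (proj₁ (remQuot {guesses} (suc n) q)) ℚ.* v (proj₂ (remQuot {guesses} (suc n) q))

    y-combine : ∀ (σ : Fin guesses) t → y (combine σ t) ≡ ℚΣ.δ σ₀ σ ℚ.* v t
    y-combine σ t = cong (λ p → ℚΣ.δ σ₀ (proj₁ p) ℚ.* v (proj₂ p)) (Finₚ.remQuot-combine σ t)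

    y-sum : ∀ t → Σℚ (λ (σ : Fin guesses) → y (combine σ t)) ≡ v t
    y-sum t = trans (ℚΣ.Σ-cong (λ σ → y-combine σ t)) (ℚΣ.Σ-δ σ₀ (λ _ → v t))

    y-chosen : ∀ t → y (combine σ₀ t) ≡ v t
    y-chosen t = trans (y-combine σ₀ t) (trans (cong (ℚ._* v t) (ℚΣ.δ-refl σ₀)) (ℚₚ.*-identityˡ (v t)))

    y-other : ∀ {σ : Fin guesses} → σ₀ ≢ σ → ∀ t → y (combine σ t) ≡ 0ℚ
    y-other {σ} σ₀≢σ t = trans (y-combine σ t) (trans (cong (ℚ._* v t) (ℚΣ.δ-≢ σ₀≢σ)) (ℚₚ.*-zeroˡ (v t)))

    x : Fin n → ℚ
    x i = toℚ (z i)

    x≡ι∣z∣ : ∀ i → x i ≡ ι ℤ.∣ z i ∣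
    x≡ι∣z∣ i = trans (cong toℚ (≡.sym (+∣z∣≡z i))) (toℚ≡ι ℤ.∣ z i ∣)

    chosen : SatGuess x y σ₀
    chosen = record
      { 0≤λ = ℚₚ.≤-trans (ℚₚ.nonNegative⁻¹ 1ℚ) (ℚₚ.≤-reflexive (≡.sym (y-chosen zero)))
      ; lower = λ i → subst₂ ℚ._≤_ (≡.sym (scaled (G.lo σ₀ i))) (≡.sym (y-chosen (suc i))) (ι-mono-≤ (lo≤m i))
      ; upper = λ i → subst₂ ℚ._≤_ (≡.sym (y-chosen (suc i))) (≡.sym (scaled (G.hi σ₀ i))) (ι-mono-≤ (m≤hi i))
      ; capacity = λ j → subst₂ ℚ._≤_
          (trans (ι-· (A j) m) (ℚΣ.Σ-cong (λ i → cong (ι (A j i) ℚ.*_) (≡.sym (y-chosen (suc i))))))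
          (≡.sym (scaled (b j))) (ι-mono-≤ (Am≤b j))
      }
      where
      scaled : ∀ a → ι a ℚ.* y (λᵛ σ₀) ≡ ι a
      scaled a = trans (cong (ι a ℚ.*_) (y-chosen zero)) (ℚₚ.*-identityʳ (ι a))

    other : ∀ {σ} → σ₀ ≢ σ → SatGuess x y σ
    other {σ} σ₀≢σ = record
      { 0≤λ = ℚₚ.≤-reflexive (≡.sym (y-other σ₀≢σ zero))
      ; lower = λ i → ℚₚ.≤-reflexive (trans (scaled (G.lo σ i)) (≡.sym (y-other σ₀≢σ (suc i))))
      ; upper = λ i → ℚₚ.≤-reflexive (trans (y-other σ₀≢σ (suc i)) (≡.sym (scaled (G.hi σ i))))
      ; capacity = λ j → ℚₚ.≤-reflexive (trans
          (trans (ℚΣ.Σ-cong (λ i → trans (cong (ι (A j i) ℚ.*_) (y-other σ₀≢σ (suc i))) (ℚₚ.*-zeroʳ (ι (A j i)))))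
                 (ℚΣ.Σ-zero {n}))
          (≡.sym (scaled (b j))))
      }
      where
      scaled : ∀ a → ι a ℚ.* y (λᵛ σ) ≡ 0ℚ
      scaled a = trans (cong (ι a ℚ.*_) (y-other σ₀≢σ zero)) (ℚₚ.*-zeroʳ (ι a))

    sat : Sat x y
    sat = record
      { weights≤1 = ℚₚ.≤-reflexive (y-sum zero)
      ; 0≤x = λ i → subst (0ℚ ℚ.≤_) (≡.sym (x≡ι∣z∣ i)) (0≤ι ℤ.∣ z i ∣)
      ; linked = λ i → linked i (item i) refl
      ; guessed = λ σ → guess σ (σ₀ Fin.≟ σ)
      }
      where
      linked : ∀ i t → m i ≡ taken t (z i) → Holds x y (link t)
      x≤X : ∀ i → m i ≡ ℤ.∣ z i ∣ → x i ℚ.≤ Σℚ (λ σ → y (Xᵛ σ i))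
      x≤X i eq = ℚₚ.≤-reflexive (trans (x≡ι∣z∣ i) (trans (cong ι (≡.sym eq)) (≡.sym (y-sum (suc i)))))
      linked i (limited _ _) eq = x≤X i eq
      linked i (packed _ _ _) eq = x≤X i eq
      linked i (free _ _) eq = ℚₚ.≤-refl
      guess : ∀ σ → Dec (σ₀ ≡ σ) → SatGuess x y σ
      guess σ (yes σ₀≡σ) = subst (SatGuess x y) σ₀≡σ chosen
      guess σ (no σ₀≢σ) = other σ₀≢σ

  isExtendedRelaxation : IsExtendedRelaxation I relaxation
  isExtendedRelaxation z = mk⇔
    (λ (y , feasible) → sound z y (feasible⇒sat (λ i → toℚ (z i)) y feasible))
    (λ feasible → Complete.y z feasible , sat⇒feasible (λ i → toℚ (z i)) (Complete.y z feasible) (Complete.sat z feasible))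

  -- Rounding an arbitrary point of the relaxation.

  natural-feasible : (w : Fin n → ℕ) → (∀ i {u} → d i ≡ just u → w i ℕ.≤ u) → (∀ j → A j ·ℕ w ℕ.≤ b j) →
                     KnapsackFeasible I (λ i → + w i)
  natural-feasible w w≤d Aw≤b = (λ i → ℤ.+≤+ z≤n , below i (d i) refl) , λ j →
    subst (ℤ._≤ + b j) (≡.sym (+-Σ (λ i → A j i ℕ.* w i) _ (λ i → ≡.sym (ℤₚ.pos-* (A j i) (w i))))) (ℤ.+≤+ (Aw≤b j))
    where
    below : ∀ i m → d i ≡ m → BelowBound (+ w i) m
    below i nothing _ = tt
    below i (just u) d≡u = ℤ.+≤+ (w≤d i d≡u)

  value-ι : ∀ c (w : Fin n → ℕ) → value c (λ i → toℚ (+ w i)) ≡ c · (ι ∘ w)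
  value-ι c w = ℚΣ.Σ-cong (λ i → cong (c i ℚ.*_) (toℚ≡ι (w i)))

  -- A free item consumes no capacity and has no upper bound, so its fractional amount can simply be
  -- replaced by a larger natural number.
  surplus : ∀ {i} → Item i → ℚ → ℕ
  surplus (limited _ _) q  = 0
  surplus (packed _ _ _) q = 0
  surplus (free _ _) q     = proj₁ (natural-upper-bound q)

  module Approx {ε : ℚ} (0≤ε : 0ℚ ℚ.≤ ε) (kg : ι k ℚ.≤ ι (suc g) ℚ.* ε) (c : Fin n → ℚ) (0≤c : ∀ i → 0ℚ ℚ.≤ c i)
                (x : Fin n → ℚ) (y : Fin variables → ℚ) (sat : Sat x y) where

    open Sat sat
    open Sound x y sat using (X; 0≤X)

    Matched : Set
    Matched = ∃ λ z → KnapsackFeasible I z × ((1ℚ ℚ.- ε) ℚ.* value c x ℚ.≤ value c (λ i → toℚ (z i)))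

    s : Fin n → ℕ
    s i = surplus (item i) (x i)

    x≤X+s : ∀ i → x i ℚ.≤ X i ℚ.+ ι (s i)
    x≤X+s i = helper (item i) (linked i)
      where
      helper : (t : Item i) → Holds x y (link t) → x i ℚ.≤ X i ℚ.+ ι (surplus t (x i))
      helper (limited _ _) x≤X = ℚₚ.≤-trans x≤X (p≤p+q (0≤ι 0))
      helper (packed _ _ _) x≤X = ℚₚ.≤-trans x≤X (p≤p+q (0≤ι 0))
      helper (free _ _) _ = ℚₚ.≤-trans (proj₂ (natural-upper-bound (x i)))
        (ℚₚ.≤-trans (ℚₚ.≤-reflexive (≡.sym (ℚₚ.+-identityˡ u))) (ℚₚ.+-monoˡ-≤ u (0≤X i)))
        where
        u : ℚ
        u = ι (proj₁ (natural-upper-bound (x i)))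

    A*s≡0 : ∀ j i → A j i ℕ.* s i ≡ 0
    A*s≡0 j i = helper (item i)
      where
      helper : (t : Item i) → A j i ℕ.* surplus t (x i) ≡ 0
      helper (limited _ _) = ℕₚ.*-zeroʳ (A j i)
      helper (packed _ _ _) = ℕₚ.*-zeroʳ (A j i)
      helper t@(free _ A≡0) = cong (ℕ._* surplus t (x i)) (A≡0 j)

    combine-surplus : (w : Fin n → ℕ) → (∀ i → w i ℕ.≤ limit i) → (∀ j → A j ·ℕ w ℕ.≤ b j) →
                      KnapsackFeasible I (λ i → + (w i ℕ.+ s i))
    combine-surplus w w≤limit Aw≤b = natural-feasible (λ i → w i ℕ.+ s i)
      (λ i d≡u → below i d≡u (item i) refl)
      (λ j → ℕₚ.≤-trans (ℕₚ.≤-reflexive (ℕΣ.Σ-cong (same j))) (Aw≤b j))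
      where
      same : ∀ j i → A j i ℕ.* (w i ℕ.+ s i) ≡ A j i ℕ.* w i
      same j i = trans (ℕₚ.*-distribˡ-+ (A j i) (w i) (s i))
        (trans (cong (A j i ℕ.* w i ℕ.+_) (A*s≡0 j i)) (ℕₚ.+-identityʳ _))
      below : ∀ i {u} → d i ≡ just u → ∀ t → item i ≡ t → w i ℕ.+ s i ℕ.≤ u
      below i d≡u t@(limited u′ d≡u′) eq with refl ← trans (≡.sym d≡u) d≡u′ = begin
        w i ℕ.+ s i  ≡⟨ cong (λ t → w i ℕ.+ surplus t (x i)) eq ⟩
        w i ℕ.+ 0    ≡⟨ ℕₚ.+-identityʳ (w i) ⟩
        w i          ≤⟨ w≤limit i ⟩
        limit i      ≡⟨ cong bound eq ⟩
        u′           ∎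
        where open ℕₚ.≤-Reasoning
      below i d≡u (packed d≡∞ _ _) _ = case trans (≡.sym d≡u) d≡∞ of λ ()
      below i d≡u (free d≡∞ _) _ = case trans (≡.sym d≡u) d≡∞ of λ ()

    Solution : Fin guesses → Set
    Solution σ = ∃ λ w → (∀ i → w i ℕ.≤ limit i) × (∀ j → A j ·ℕ w ℕ.≤ b j) ×
                         (1ℚ ℚ.- ε) ℚ.* (c · (y ∘ Xᵛ σ)) ℚ.≤ y (λᵛ σ) ℚ.* (c · (ι ∘ w))

    -- Up to the free items, the profit of `x` is at most that of the scaled copies together. Their
    -- rounded solutions have a weighted profit of at most that of the best one, the weights summing
    -- to at most 1; the surplus of free items is then added on top.
    assemble : 0ℚ ℚ.≤ 1ℚ ℚ.- ε → (∀ σ → Solution σ) → Matched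
    assemble 0≤θ solution = (λ i → + (w best i ℕ.+ s i))
      , combine-surplus (w best) (proj₁ (proj₂ (solution best))) (proj₁ (proj₂ (proj₂ (solution best))))
      , (begin
      θ ℚ.* (c · x)                                            ≤⟨ *-mono-≤ˡ 0≤θ (·-mono 0≤c x≤X+s) ⟩
      θ ℚ.* (c · (λ i → X i ℚ.+ ι (s i)))                      ≡⟨ cong (θ ℚ.*_) (·-distrib-+ c X (ι ∘ s)) ⟩
      θ ℚ.* (c · X ℚ.+ cs)                                     ≡⟨ ℚₚ.*-distribˡ-+ θ (c · X) cs ⟩
      θ ℚ.* (c · X) ℚ.+ θ ℚ.* cs                               ≤⟨ ℚₚ.+-mono-≤ θcX≤ θcs≤cs ⟩
      c · (ι ∘ w best) ℚ.+ cs                                  ≡⟨ ·-distrib-+ c (ι ∘ w best) (ι ∘ s) ⟨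
      c · (λ i → ι (w best i) ℚ.+ ι (s i))                     ≡⟨ ℚΣ.Σ-cong (λ i → cong (c i ℚ.*_) (ι-homo-+ (w best i) (s i))) ⟨
      c · (λ i → ι (w best i ℕ.+ s i))                         ≡⟨ value-ι c (λ i → w best i ℕ.+ s i) ⟨
      value c (λ i → toℚ (+ (w best i ℕ.+ s i)))               ∎)
      where
      open ℚₚ.≤-Reasoning
      θ cs : ℚ
      θ = 1ℚ ℚ.- ε
      cs = c · (ι ∘ s)
      w : Fin guesses → Fin n → ℕ
      w σ = proj₁ (solution σ)
      profit : Fin guesses → ℚ
      profit σ = c · (ι ∘ w σ)
      most-profitable : ∃ λ σ → ⊤ × (∀ τ → ⊤ → profit τ ℚ.≤ profit σ)
      most-profitable = Selection.least {_≤_ = λ p q → q ℚ.≤ p} (λ p q → ℚₚ.≤-trans q p) (λ p q → ℚₚ.≤-total q p)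
        -- The all-dummy guess witnesses that there is a guess to choose from.
        profit (λ _ → yes tt) (encode (λ _ _ → zero) , tt)
      best : Fin guesses
      best = proj₁ most-profitable
      θcs≤cs : θ ℚ.* cs ℚ.≤ cs
      θcs≤cs = ℚₚ.≤-trans (*-mono-≤ʳ (·-nonneg 0≤c (λ i → 0≤ι (s i)))
        (ℚₚ.≤-trans (ℚₚ.+-monoʳ-≤ 1ℚ (ℚₚ.neg-antimono-≤ 0≤ε)) (ℚₚ.≤-reflexive (ℚₚ.+-identityʳ 1ℚ))))
        (ℚₚ.≤-reflexive (ℚₚ.*-identityˡ cs))
      θcX≤ : θ ℚ.* (c · X) ℚ.≤ profit best
      θcX≤ = begin
        θ ℚ.* (c · X)                                          ≡⟨ cong (θ ℚ.*_) (·-Σ c (λ σ → y ∘ Xᵛ σ)) ⟩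
        θ ℚ.* Σℚ (λ σ → c · (y ∘ Xᵛ σ))                        ≡⟨ ℚΣ.Σ-distribˡ-* θ (λ σ → c · (y ∘ Xᵛ σ)) ⟨
        Σℚ (λ σ → θ ℚ.* (c · (y ∘ Xᵛ σ)))                      ≤⟨ ℚΣ.Σ-mono (λ σ → proj₂ (proj₂ (proj₂ (solution σ)))) ⟩
        Σℚ (λ σ → y (λᵛ σ) ℚ.* profit σ)
          ≤⟨ ℚΣ.Σ-mono (λ σ → *-mono-≤ˡ (SatGuess.0≤λ (guessed σ)) (proj₂ (proj₂ most-profitable) σ tt)) ⟩
        Σℚ (λ σ → y (λᵛ σ) ℚ.* profit best)                    ≡⟨ ℚΣ.Σ-distribʳ-* (profit best) (λ σ → y (λᵛ σ)) ⟩
        Σℚ (λ σ → y (λᵛ σ)) ℚ.* profit best                    ≤⟨ *-mono-≤ʳ (·-nonneg 0≤c (λ i → 0≤ι (w best i))) weights≤1 ⟩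
        1ℚ ℚ.* profit best                                     ≡⟨ ℚₚ.*-identityˡ (profit best) ⟩
        profit best                                            ∎

    -- For `ε ≥ 1` the factor `1 - ε` is not positive, so multiplying by it would reverse the
    -- inequalities of `assemble`; the zero solution is good enough here.
    trivial : 1ℚ ℚ.- ε ℚ.≤ 0ℚ → Matched
    trivial θ≤0 = (λ _ → + 0)
      , natural-feasible (λ _ → 0) (λ _ _ → z≤n)
          (λ j → ℕₚ.≤-trans (ℕₚ.≤-reflexive (trans (ℕΣ.Σ-cong (λ i → ℕₚ.*-zeroʳ (A j i))) (ℕΣ.Σ-zero {n}))) z≤n)
      , (begin
      (1ℚ ℚ.- ε) ℚ.* (c · x)      ≤⟨ *-mono-≤ʳ (·-nonneg 0≤c 0≤x) θ≤0 ⟩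
      0ℚ ℚ.* (c · x)              ≡⟨ ℚₚ.*-zeroˡ (c · x) ⟩
      0ℚ                          ≤⟨ ·-nonneg 0≤c (λ _ → 0≤ι 0) ⟩
      c · (λ _ → ι 0)             ≡⟨ value-ι c (λ _ → 0) ⟨
      value c (λ _ → toℚ (+ 0))   ∎)
      where open ℚₚ.≤-Reasoning

    matched : Matched
    matched = case ℚₚ.≤-total 0ℚ (1ℚ ℚ.- ε) of λ
      { (inj₁ 0≤θ) → assemble 0≤θ (λ σ → let open SatGuess (guessed σ) in
          round-scaled-guess g A b limit (decode σ) ε kg c 0≤c {y (λᵛ σ)} {y ∘ Xᵛ σ} 0≤θ 0≤λ
            (λ i → lower i , upper i) capacity)
      ; (inj₂ θ≤0) → trivial θ≤0
      }

  approxGuarantee : ∀ {ε} → 0ℚ ℚ.≤ ε → ι k ℚ.≤ ι (suc g) ℚ.* ε →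
                    (c : Fin n → ℚ) → (∀ i → 0ℚ ℚ.≤ c i) → ApproxGuarantee I relaxation ε c
  approxGuarantee 0≤ε kg c 0≤c x y feasible = Approx.matched 0≤ε kg c 0≤c x y (feasible⇒sat x y feasible)

  -- Size of the relaxation.

  length-guessRows : ∀ σ → List.length (guessRows σ) ≡ suc (n ℕ.+ (n ℕ.+ k))
  length-guessRows σ = cong suc (trans (Listₚ.length-++ (List.tabulate (lowerRow σ)))
    (cong₂ ℕ._+_ (Listₚ.length-tabulate (lowerRow σ)) (trans (Listₚ.length-++ (List.tabulate (upperRow σ)))
      (cong₂ ℕ._+_ (Listₚ.length-tabulate (upperRow σ)) (Listₚ.length-tabulate (capacityRow σ))))))

  length-rows : List.length rows ≡ suc (n ℕ.+ (n ℕ.+ guesses ℕ.* suc (n ℕ.+ (n ℕ.+ k))))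
  length-rows = cong suc (trans (Listₚ.length-++ (List.tabulate nonnegRow))
    (cong₂ ℕ._+_ (Listₚ.length-tabulate nonnegRow) (trans (Listₚ.length-++ (List.tabulate linkRow))
      (cong₂ ℕ._+_ (Listₚ.length-tabulate linkRow) (length-concat-tabulate guessRows length-guessRows)))))

  k+n≤inputSize : k ℕ.+ n ℕ.≤ inputSize I
  k+n≤inputSize = ℕₚ.≤-trans (ℕₚ.m≤m+n (k ℕ.+ n) _) (ℕₚ.≤-trans (ℕₚ.m≤m+n _ _) (ℕₚ.m≤m+n _ _))

  -- With s = 1 + input size there are at most P = s ^ (suc g * k * k) guesses, each adding at most
  -- 3 s variables and rows. The rest contributes at most 3 s, which is at most 3 s P; hence the
  -- constant 6 and one further factor s in the exponent.
  lpSize-≤ : lpSize relaxation ℕ.≤ 6 ℕ.* suc (inputSize I) ^ suc (suc g ℕ.* k ℕ.* k)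
  lpSize-≤ = begin
    n ℕ.+ guesses ℕ.* suc n ℕ.+ List.length rows
      ≡⟨ cong (n ℕ.+ guesses ℕ.* suc n ℕ.+_) length-rows ⟩
    n ℕ.+ guesses ℕ.* suc n ℕ.+ suc (n ℕ.+ (n ℕ.+ guesses ℕ.* suc (n ℕ.+ (n ℕ.+ k))))
      ≡⟨ solve 3 (λ n p k → n :+ p :* (con 1 :+ n) :+ (con 1 :+ (n :+ (n :+ p :* (con 1 :+ (n :+ (n :+ k))))))
                         := con 2 :* n :+ (con 1 :+ n) :+ p :* ((con 1 :+ n) :+ ((con 1 :+ n) :+ (k :+ n)))) refl n guesses k ⟩
    2 ℕ.* n ℕ.+ suc n ℕ.+ guesses ℕ.* (suc n ℕ.+ (suc n ℕ.+ (k ℕ.+ n)))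
      ≤⟨ ℕₚ.+-mono-≤ (ℕₚ.+-mono-≤ (ℕₚ.*-monoʳ-≤ 2 n≤s) 1+n≤s)
                     (ℕₚ.*-mono-≤ guesses≤P (ℕₚ.+-mono-≤ 1+n≤s (ℕₚ.+-mono-≤ 1+n≤s k+n≤s))) ⟩
    2 ℕ.* s ℕ.+ s ℕ.+ P ℕ.* (s ℕ.+ (s ℕ.+ s))
      ≡⟨ solve 2 (λ s p → con 2 :* s :+ s :+ p :* (s :+ (s :+ s)) := con 3 :* s :+ con 3 :* (s :* p)) refl s P ⟩
    3 ℕ.* s ℕ.+ 3 ℕ.* (s ℕ.* P)
      ≤⟨ ℕₚ.+-monoˡ-≤ (3 ℕ.* (s ℕ.* P)) (ℕₚ.*-monoʳ-≤ 3 (ℕₚ.m≤m*n s P {{ℕₚ.m^n≢0 s (suc g ℕ.* k ℕ.* k)}})) ⟩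
    3 ℕ.* (s ℕ.* P) ℕ.+ 3 ℕ.* (s ℕ.* P)
      ≡⟨ solve 1 (λ q → con 3 :* q :+ con 3 :* q := con 6 :* q) refl (s ℕ.* P) ⟩
    6 ℕ.* (s ℕ.* P)  ∎
    where
    open ℕₚ.≤-Reasoning
    open ℕ-Solver.+-*-Solver
    s P : ℕ
    s = suc (inputSize I)
    P = s ^ (suc g ℕ.* k ℕ.* k)
    k+n≤s : k ℕ.+ n ℕ.≤ s
    k+n≤s = ℕₚ.m≤n⇒m≤1+n k+n≤inputSize
    n≤s : n ℕ.≤ s
    n≤s = ℕₚ.≤-trans (ℕₚ.m≤n+m n k) k+n≤s
    1+n≤s : suc n ℕ.≤ s
    1+n≤s = s≤s (ℕₚ.≤-trans (ℕₚ.m≤n+m n k) k+n≤inputSize)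
    guesses≤P : guesses ℕ.≤ P
    guesses≤P = ℕₚ.≤-trans (ℕₚ.≤-reflexive (ℕₚ.^-*-assoc (suc n) (suc g ℕ.* k) k))
                           (ℕₚ.^-monoˡ-≤ (suc g ℕ.* k ℕ.* k) 1+n≤s)

theorem2 : (k : ℕ) → 1 ℕ.≤ k → (ε : ℚ) → 0ℚ ℚ.< ε →
    Σ ℕ λ C → Σ ℕ λ e →
    Σ ((I : KnapsackData k) → ExtLP (KnapsackData.n I)) λ L →
    (I : KnapsackData k) →
    (lpSize (L I) ℕ.≤ C ℕ.* (suc (inputSize I) ^ e)) ×
    IsExtendedRelaxation I (L I) ×
    ((c : _) → (∀ i → 0ℚ ℚ.≤ c i) → ApproxGuarantee I (L I) ε c)
theorem2 k _ ε 0<ε =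
  -- `g` is fixed before the instance is seen, so the exponent depends on `k` and `ε` only.
  let (g , kg) = archimedean (ι k) 0<ε in
  6 , suc (suc g ℕ.* k ℕ.* k) , (λ I → Relaxation.relaxation I g) , λ I →
    Relaxation.lpSize-≤ I g , Relaxation.isExtendedRelaxation I g , Relaxation.approxGuarantee I g (ℚₚ.<⇒≤ 0<ε) kg
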